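{- Let $\phi:\mathbb{N}\to\mathbb{R}^{+}$ be an arbitrary positive function and let $F(\phi)=\{x\in(0,1]: d_n(x)\ge \phi(n)\text{ for infinitely many } n\}$. Let $\mathcal{L}$ denote Lebesgue measure on $(0,1]$. If $\sum_{n=1}^{\infty}2^{ -\phi(n)}<\infty$ then $\mathcal{L}(F(\phi))=0$, and if $\sum_{n=1}^{\infty}2^{ -\phi(n)}=\infty$ then $\mathcal{L}(F(\phi))=1$.
   Context: $\mathbb{N}=\{1,2,3,\dots\}$. Every $x\in(0,1]$ has a unique expansion $x=\sum_{i=1}^{\infty}2^{ -(d_1(x)+d_2(x)+\cdots+d_i(x))}$ with all $d_i(x)\in\mathbb{N}$ (the power-2-decaying Gauss-like expansion); this defines the digit functions $d_i:(0,1]\to\mathbb{N}$. Equivalently, with $T:(0,1]\to(0,1]$ given by $Tx=2^nx-1$ for $x\in(2^{ -n},2^{ -(n-1)}]$, $n\in\mathbb{N}$, the digit $d_i(x)$ is the unique $n\in\mathbb{N}$ with $T^{i-1}x\in(2^{ -n},2^{ -(n-1)}]$. -}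

module Defs where

open import Data.Empty using (⊥-elim)
open import Data.Integer.Base as ℤ using (+_)
import Data.Integer.Properties as ℤ
open import Data.Nat.Base as ℕ using (ℕ; zero; suc)
import Data.Nat.Properties as ℕ
open import Data.Product using (∃-syntax; _×_; _,_)
open import Data.Rational.Base as ℚ using (ℚ; 0ℚ; 1ℚ; ½; _/_)
import Data.Rational.Properties as ℚ
open import Data.Rational.Unnormalised.Base as ℚᵘ using (mkℚᵘ)
import Data.Rational.Unnormalised.Properties as ℚᵘ
open import Relation.Binary.Definitions using (tri<; tri≈; tri>)
open import Relation.Binary.PropositionalEquality using (refl; subst; subst₂)
open import Relation.Nullary using (¬_)

open import Algebra.Definitions.RawSemiring ℚ.+-*-rawSemiring using (_^_)

------------------------------------------------------------------------
-- Real numbers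

-- A real is the set of rationals strictly below it.  Such one-sided cuts form
-- the usual complete ordered field once excluded middle is assumed.
record ℝ : Set₁ where
  field
    Below     : ℚ → Set
    inhabited : ∃[ q ] Below q
    bounded   : ∃[ q ] ¬ Below q
    closed    : ∀ {q r} → q ℚ.< r → Below r → Below q
    rounded   : ∀ {q} → Below q → ∃[ r ] (q ℚ.< r × Below r)

open ℝ public

infix 4 _≤_ _<_ _≃_

_≤_ : ℝ → ℝ → Set
x ≤ y = ∀ q → Below x q → Below y q

_<_ : ℝ → ℝ → Set
x < y = ∃[ q ] (Below y q × ¬ Below x q)

_≃_ : ℝ → ℝ → Set
x ≃ y = x ≤ y × y ≤ x

q-1<q : ∀ q → q ℚ.- 1ℚ ℚ.< q
q-1<q q = subst (q ℚ.- 1ℚ ℚ.<_) (ℚ.+-identityʳ q) (ℚ.+-monoʳ-< q (ℚ.negative⁻¹ (ℚ.- 1ℚ)))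

below-<-above : ∀ x {a u} → Below x a → ¬ Below x u → a ℚ.< u
below-<-above x {a} {u} a∈x u∉x with ℚ.<-cmp a u
... | tri< a<u _ _ = a<u
... | tri≈ _ refl _ = ⊥-elim (u∉x a∈x)
... | tri> _ _ u<a = ⊥-elim (u∉x (closed x u<a a∈x))

fromℚ : ℚ → ℝ
fromℚ p .Below q = q ℚ.< p
fromℚ p .inhabited = p ℚ.- 1ℚ , q-1<q p
fromℚ p .bounded = p , ℚ.<-irrefl refl
fromℚ p .closed = ℚ.<-trans
fromℚ p .rounded q<p = ℚ.<-dense q<p

fromℕ : ℕ → ℝ
fromℕ n = fromℚ (+ n / 1)

infixl 6 _+_

_+_ : ℝ → ℝ → ℝ
(x + y) .Below q = ∃[ a ] ∃[ b ] (Below x a × Below y b × q ℚ.< a ℚ.+ b)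
(x + y) .inhabited =
  let a , a∈x = inhabited x
      b , b∈y = inhabited y
  in a ℚ.+ b ℚ.- 1ℚ , a , b , a∈x , b∈y , q-1<q (a ℚ.+ b)
(x + y) .bounded =
  let u , u∉x = bounded x
      v , v∉y = bounded y
  in u ℚ.+ v , λ (a , b , a∈x , b∈y , u+v<a+b) →
       ℚ.<-asym u+v<a+b
         (ℚ.+-mono-< (below-<-above x a∈x u∉x) (below-<-above y b∈y v∉y))
(x + y) .closed q<r (a , b , a∈x , b∈y , r<a+b) =
  a , b , a∈x , b∈y , ℚ.<-trans q<r r<a+b
(x + y) .rounded (a , b , a∈x , b∈y , q<a+b) =
  let r , q<r , r<a+b = ℚ.<-dense q<a+b
  in r , q<r , a , b , a∈x , b∈y , r<a+b

record ℝ⁺ : Set₁ where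
  field
    value    : ℝ
    positive : fromℚ 0ℚ < value

open ℝ⁺ public

above-natural : ∀ (u : ℚ) → ∃[ p ] (u ℚ.≤ (+ p / 1))
above-natural u = ℤ.∣ ℚ.↥ u ∣ , le u
  where
  numerator-bound : ∀ (i : ℤ.ℤ) d → i ℤ.* + 1 ℤ.≤ + ℤ.∣ i ∣ ℤ.* + suc d
  numerator-bound (+ n) d =
    subst₂ ℤ._≤_ (ℤ.pos-* n 1) (ℤ.pos-* n (suc d))
      (ℤ.+≤+ (ℕ.*-monoʳ-≤ n (ℕ.s≤s ℕ.z≤n)))
  numerator-bound (ℤ.-[1+ n ]) d = ℤ.-≤+

  le : ∀ u → u ℚ.≤ (+ ℤ.∣ ℚ.↥ u ∣ / 1)
  le u@(ℚ.mkℚ n d _) = ℚ.toℚᵘ-cancel-≤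
    (ℚᵘ.≤-trans (ℚᵘ.*≤* {mkℚᵘ n d} {mkℚᵘ (+ ℤ.∣ n ∣) 0} (numerator-bound n d))
      (ℚᵘ.≤-reflexive (ℚᵘ.≃-sym (ℚ.toℚᵘ-fromℚᵘ (mkℚᵘ (+ ℤ.∣ n ∣) 0)))))

½^p≤1 : ∀ p → ½ ^ p ℚ.≤ 1ℚ
½^p≤1 zero    = ℚ.≤-refl
½^p≤1 (suc p) = ℚ.≤-trans (ℚ.*-monoˡ-≤-nonNeg ½ (½^p≤1 p)) (ℚ.<⇒≤ (ℚ.*<* (ℤ.+<+ (ℕ.s≤s (ℕ.s≤s ℕ.z≤n)))))

0≤½^p : ∀ p → 0ℚ ℚ.≤ ½ ^ p
0≤½^p zero    = ℚ.nonNegative⁻¹ 1ℚ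
0≤½^p (suc p) = ℚ.*-monoˡ-≤-nonNeg ½ (0≤½^p p)

1≤s^n : ∀ {s} → 1ℚ ℚ.< s → ∀ n → 1ℚ ℚ.≤ s ^ n
1≤s^n 1<s zero = ℚ.≤-refl
1≤s^n {s} 1<s (suc n) = ℚ.≤-trans (ℚ.<⇒≤ 1<s)
  (subst (ℚ._≤ s ℚ.* s ^ n) (ℚ.*-identityʳ s)
    (ℚ.*-monoˡ-≤-nonNeg s {{ℚ.nonNegative (ℚ.<⇒≤ (ℚ.<-trans (ℚ.positive⁻¹ 1ℚ) 1<s))}} (1≤s^n 1<s n)))

1<s^1+n : ∀ {s} → 1ℚ ℚ.< s → ∀ n → 1ℚ ℚ.< s ^ suc n
1<s^1+n {s} 1<s n = ℚ.<-≤-trans 1<s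
  (subst (ℚ._≤ s ℚ.* s ^ n) (ℚ.*-identityʳ s)
    (ℚ.*-monoˡ-≤-nonNeg s {{ℚ.nonNegative (ℚ.<⇒≤ (ℚ.<-trans (ℚ.positive⁻¹ 1ℚ) 1<s))}} (1≤s^n 1<s n)))

-- 2^(-y) is the supremum of the 2^(-p/(1+k)) over the rationals p/(1+k) ≥ y,
-- and for s ≥ 0, s ≤ 2^(-p/(1+k)) means s^(1+k) ≤ (1/2)^p.  Numerators p : ℕ
-- are enough because y > 0.
2^-_ : ℝ⁺ → ℝ
(2^- y) .Below r =
  ∃[ p ] ∃[ k ] ∃[ s ]
    (value y ≤ fromℚ (+ p / suc k) × 0ℚ ℚ.≤ s × s ^ suc k ℚ.≤ ½ ^ p × r ℚ.< s)
(2^- y) .inhabited =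
  let u , u∉y = bounded (value y)
      p , u≤p = above-natural u
  in ℚ.- 1ℚ , p , 0 , 0ℚ
   , (λ q q∈y → ℚ.<-≤-trans (below-<-above (value y) q∈y u∉y) u≤p)
   , ℚ.≤-refl , 0≤½^p p , ℚ.negative⁻¹ (ℚ.- 1ℚ)
(2^- y) .bounded = 1ℚ , λ (p , k , s , _ , _ , s^≤ , 1<s) →
  ℚ.<-irrefl refl (ℚ.<-≤-trans (1<s^1+n 1<s k) (ℚ.≤-trans s^≤ (½^p≤1 p)))
(2^- y) .closed q<r (p , k , s , y≤ , 0≤s , s^≤ , r<s) =
  p , k , s , y≤ , 0≤s , s^≤ , ℚ.<-trans q<r r<s
(2^- y) .rounded (p , k , s , y≤ , 0≤s , s^≤ , q<s) =
  let r , q<r , r<s = ℚ.<-dense q<s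
  in r , q<r , p , k , s , y≤ , 0≤s , s^≤ , r<s

------------------------------------------------------------------------
-- Series

∑ℚ : (ℕ → ℚ) → ℕ → ℚ
∑ℚ a zero    = 0ℚ
∑ℚ a (suc n) = ∑ℚ a n ℚ.+ a n

∑ : (ℕ → ℝ) → ℕ → ℝ
∑ a zero    = fromℚ 0ℚ
∑ a (suc n) = ∑ a n + a n

-- For series of nonnegative terms: the sum in [0,∞] is finite, respectively
-- infinite.
∑<∞ : (ℕ → ℝ) → Set₁
∑<∞ a = ∃[ B ] ∀ n → ∑ a n ≤ B

∑=∞ : (ℕ → ℝ) → Set₁
∑=∞ a = ∀ B → ∃[ n ] B < ∑ a n

-- |s n - x| ≤ ε for all large n.
_⟶_ : (ℕ → ℚ) → ℝ → Set
s ⟶ x = ∀ ε → 0ℚ ℚ.< ε → ∃[ N ] ∀ n → N ℕ.≤ n →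
  (fromℚ (s n ℚ.- ε) ≤ x × x ≤ fromℚ (s n ℚ.+ ε))

------------------------------------------------------------------------
-- Lebesgue measure

Subset : Set₁
Subset = ℝ → Set

_∩_ : Subset → Subset → Subset
(A ∩ B) x = A x × B x

_∖_ : Subset → Subset → Subset
(A ∖ B) x = A x × ¬ B x

record OpenInterval : Set where
  field
    left right : ℚ
    left≤right : left ℚ.≤ right

  length : ℚ
  length = right ℚ.- left

open OpenInterval public

_∈_ : ℝ → OpenInterval → Set
x ∈ I = fromℚ (left I) < x × x < fromℚ (right I)

_CoveredBy_ : Subset → (ℕ → OpenInterval) → Set₁
A CoveredBy I = ∀ x → A x → ∃[ k ] x ∈ I k

-- t bounds the total length of some countable cover of A by open intervals.
CoverTotal : Subset → ℚ → Set₁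
CoverTotal A t =
  ∃[ I ] (A CoveredBy I × (∀ n → ∑ℚ (λ k → length (I k)) n ℚ.≤ t))

-- m is the infimum of the total lengths of covers of A, i.e. λ*(A) = m < ∞.
-- (Rational endpoints and rational bounds on totals do not change the infimum.)
IsOuterMeasure : Subset → ℝ → Set₁
IsOuterMeasure A m =
    (∀ t → CoverTotal A t → m ≤ fromℚ t)
  × (∀ b → (∀ t → CoverTotal A t → b ≤ fromℚ t) → b ≤ m)

-- Carathéodory's criterion; test sets of infinite outer measure satisfy it
-- automatically by subadditivity, so they are left out.
Measurable : Subset → Set₁
Measurable A = ∀ (E : Subset) (e a b : ℝ) →
  IsOuterMeasure E e → IsOuterMeasure (E ∩ A) a → IsOuterMeasure (E ∖ A) b →
  e ≃ a + b

-- A is Lebesgue measurable with measure m.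
𝓛_≐_ : Subset → ℝ → Set₁
𝓛 A ≐ m = Measurable A × IsOuterMeasure A m

------------------------------------------------------------------------
-- The power-2-decaying Gauss-like expansion

-- Sequences are indexed from 0: d i is the digit d_{i+1}, φ n is φ(n+1).

digitSum : (ℕ → ℕ) → ℕ → ℕ
digitSum d zero    = d zero
digitSum d (suc i) = digitSum d i ℕ.+ d (suc i)

IsExpansion : ℝ → (ℕ → ℕ) → Set
IsExpansion x d =
  (∀ i → 1 ℕ.≤ d i) × (∑ℚ (λ i → ½ ^ digitSum d i) ⟶ x)

-- Each x in (0,1] has exactly one expansion d, whose entries are the d_n(x).
F : (ℕ → ℝ⁺) → Subset
F φ x =
    fromℚ 0ℚ < x × x ≤ fromℚ 1ℚ
  × ∃[ d ] (IsExpansion x d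
           × (∀ N → ∃[ n ] (N ℕ.≤ n × value (φ n) ≤ fromℕ (d n))))

{-# OPTIONS --safe #-}
-- With e_n the integer such that e_n < φ(n) ≤ e_n + 1, d_n(x) ≥ φ(n) means
-- d_n(x) > e_n, and 2^(-φ(n)) lies between 2^(-e_n-1) and 2^(-e_n).  The
-- inverse branches of T scale lengths by 2^(-m), and these factors add up to 1,
-- so {d_n > e} can be covered with total 2·2^(-e) whatever n is, which gives
-- the convergent half by Borel–Cantelli.  The same recursion covers
-- {d_n ≤ e_n for N ≤ n < N + m} with total 2·∏(1 - 2^(-e_n)), and
-- ∏(1 - w)·(1 + ∑w) ≤ 1 makes this small when ∑2^(-e_n) diverges.  Only the
-- existence of expansions is needed, not their uniqueness.
module Submission where

open import Defs
open import Axiom.ExcludedMiddle using (ExcludedMiddle)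
open import Data.Empty using (⊥-elim)
open import Data.Integer.Base as ℤ using (+_)
import Data.Integer.Properties as ℤ
open import Data.Nat.Base as ℕ using (ℕ; zero; suc)
import Data.Nat.Properties as ℕ
open import Data.Product using (∃-syntax; _×_; _,_; proj₁; proj₂)
open import Data.Rational.Base as ℚ using (ℚ; 0ℚ; 1ℚ; ½; _/_)
import Data.Rational.Properties as ℚ
open import Data.Rational.Solver using (module +-*-Solver)
open import Data.Rational.Unnormalised.Base as ℚᵘ using (mkℚᵘ)
import Data.Rational.Unnormalised.Properties as ℚᵘ
open import Data.Sum.Base as Sum using (_⊎_; inj₁; inj₂)
open import Function.Base using (_∘_)
open import Level as Level using (0ℓ)
open import Relation.Binary.PropositionalEquality
  using (_≡_; refl; sym; trans; cong; cong₂; subst; subst₂; module ≡-Reasoning)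
open import Relation.Nullary using (¬_; Dec; yes; no)
open import Relation.Nullary.Decidable using (map′)

open import Algebra.Definitions.RawSemiring ℚ.+-*-rawSemiring using (_^_)
open +-*-Solver

-- Rational arithmetic

-- The covering estimates are made for digit sequences rather than for reals: there T is the shift
-- `d ∘ suc`, its inverse branches prepend a digit, and only rational partial sums are compared.
-- Reals enter when a cover of sequences is carried over to the numbers that they expand. Both
-- halves are upper bounds on covers. The one lower bound is that (0,1] has no cover of total below
-- 1; it is applied to a cover of `F φ` joined with a small cover of the rest of (0,1].
-- Carathéodory's criterion speaks of outer measures that are arbitrary cuts, so measurability goes
-- through `Splits`, a statement about covers with rational totals and an error ε.

≤-by : ∀ {p q} z → 0ℚ ℚ.≤ z → q ≡ p ℚ.+ z → p ℚ.≤ q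
≤-by {p} z 0≤z refl = subst (ℚ._≤ p ℚ.+ z) (ℚ.+-identityʳ p) (ℚ.+-monoʳ-≤ p 0≤z)

<-by : ∀ {p q} z → 0ℚ ℚ.< z → q ≡ p ℚ.+ z → p ℚ.< q
<-by {p} z 0<z refl = subst (ℚ._< p ℚ.+ z) (ℚ.+-identityʳ p) (ℚ.+-monoʳ-< p 0<z)

p≤q⇒0≤q-p : ∀ {p q} → p ℚ.≤ q → 0ℚ ℚ.≤ q ℚ.- p
p≤q⇒0≤q-p {p} {q} p≤q = subst (ℚ._≤ q ℚ.- p) (ℚ.+-inverseʳ p) (ℚ.+-monoˡ-≤ (ℚ.- p) p≤q)

p<q⇒0<q-p : ∀ {p q} → p ℚ.< q → 0ℚ ℚ.< q ℚ.- p
p<q⇒0<q-p {p} {q} p<q = subst (ℚ._< q ℚ.- p) (ℚ.+-inverseʳ p) (ℚ.+-monoˡ-< (ℚ.- p) p<q)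

*-monoˡ-≤ : ∀ {r p q} → 0ℚ ℚ.≤ r → p ℚ.≤ q → r ℚ.* p ℚ.≤ r ℚ.* q
*-monoˡ-≤ {r} 0≤r = ℚ.*-monoˡ-≤-nonNeg r {{ℚ.nonNegative 0≤r}}

0≤p*q : ∀ {p q} → 0ℚ ℚ.≤ p → 0ℚ ℚ.≤ q → 0ℚ ℚ.≤ p ℚ.* q
0≤p*q {p} {q} 0≤p 0≤q = subst (ℚ._≤ p ℚ.* q) (ℚ.*-zeroʳ p) (*-monoˡ-≤ 0≤p 0≤q)

0<p*q : ∀ {p q} → 0ℚ ℚ.< p → 0ℚ ℚ.< q → 0ℚ ℚ.< p ℚ.* q
0<p*q {p} {q} 0<p 0<q =
  subst (ℚ._< p ℚ.* q) (ℚ.*-zeroʳ p) (ℚ.*-monoʳ-<-pos p {{ℚ.positive 0<p}} 0<q)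

0≤½ : 0ℚ ℚ.≤ ½
0≤½ = ℚ.nonNegative⁻¹ ½

0<½ : 0ℚ ℚ.< ½
0<½ = ℚ.positive⁻¹ ½

0≤1 : 0ℚ ℚ.≤ 1ℚ
0≤1 = ℚ.nonNegative⁻¹ 1ℚ

½*p+½*p≡p : ∀ p → ½ ℚ.* p ℚ.+ ½ ℚ.* p ≡ p
½*p+½*p≡p = solve 1 (λ p → con ½ :* p :+ con ½ :* p := p) refl

0<½^n : ∀ n → 0ℚ ℚ.< ½ ^ n
0<½^n zero    = ℚ.positive⁻¹ 1ℚ
0<½^n (suc n) = 0<p*q 0<½ (0<½^n n)

½^-antimono : ∀ {m n} → m ℕ.≤ n → ½ ^ n ℚ.≤ ½ ^ m
½^-antimono {n = n} ℕ.z≤n = ½^p≤1 n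
½^-antimono (ℕ.s≤s m≤n) = *-monoˡ-≤ 0≤½ (½^-antimono m≤n)

½^-+ : ∀ m n → ½ ^ (m ℕ.+ n) ≡ ½ ^ m ℚ.* ½ ^ n
½^-+ zero    n = sym (ℚ.*-identityˡ (½ ^ n))
½^-+ (suc m) n = trans (cong (½ ℚ.*_) (½^-+ m n)) (sym (ℚ.*-assoc ½ (½ ^ m) (½ ^ n)))

p≤q+ε⇒p≤q : ∀ {p q} → (∀ ε → 0ℚ ℚ.< ε → p ℚ.≤ q ℚ.+ ε) → p ℚ.≤ q
p≤q+ε⇒p≤q {p} {q} p≤q+ε with p ℚ.≤? q
... | yes p≤q = p≤q
... | no  p≰q = ⊥-elim (ℚ.<-irrefl refl (ℚ.<-≤-trans q+ε<p (p≤q+ε ε (0<p*q 0<½ 0<p-q))))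
  where
  0<p-q = p<q⇒0<q-p (ℚ.≰⇒> p≰q)
  ε = ½ ℚ.* (p ℚ.- q)
  q+ε<p : q ℚ.+ ε ℚ.< p
  q+ε<p = <-by ε (0<p*q 0<½ 0<p-q)
    (solve 2 (λ p q → p := q :+ con ½ :* (p :- q) :+ con ½ :* (p :- q)) refl p q)

-- Finite sums

∑-mono-< : ∀ {f g} n → (∀ {k} → k ℕ.< n → f k ℚ.≤ g k) → ∑ℚ f n ℚ.≤ ∑ℚ g n
∑-mono-< zero    f≤g = ℚ.≤-refl
∑-mono-< (suc n) f≤g = ℚ.+-mono-≤ (∑-mono-< n (λ k<n → f≤g (ℕ.m<n⇒m<1+n k<n))) (f≤g ℕ.≤-refl)

∑-mono : ∀ {f g} → (∀ k → f k ℚ.≤ g k) → ∀ n → ∑ℚ f n ℚ.≤ ∑ℚ g n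
∑-mono f≤g n = ∑-mono-< n (λ {k} _ → f≤g k)

∑-cong : ∀ {f g} → (∀ k → f k ≡ g k) → ∀ n → ∑ℚ f n ≡ ∑ℚ g n
∑-cong f≡g zero    = refl
∑-cong f≡g (suc n) = cong₂ ℚ._+_ (∑-cong f≡g n) (f≡g n)

∑-0 : ∀ n → ∑ℚ (λ _ → 0ℚ) n ≡ 0ℚ
∑-0 zero    = refl
∑-0 (suc n) = trans (ℚ.+-identityʳ _) (∑-0 n)

∑-* : ∀ c f n → ∑ℚ (λ k → c ℚ.* f k) n ≡ c ℚ.* ∑ℚ f n
∑-* c f zero    = sym (ℚ.*-zeroʳ c)
∑-* c f (suc n) = trans (cong (ℚ._+ c ℚ.* f n) (∑-* c f n)) (sym (ℚ.*-distribˡ-+ c (∑ℚ f n) (f n)))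

∑-+ : ∀ f g n → ∑ℚ (λ k → f k ℚ.+ g k) n ≡ ∑ℚ f n ℚ.+ ∑ℚ g n
∑-+ f g zero    = refl
∑-+ f g (suc n) = trans (cong (ℚ._+ (f n ℚ.+ g n)) (∑-+ f g n))
  (solve 4 (λ a b c d → (a :+ b) :+ (c :+ d) := (a :+ c) :+ (b :+ d)) refl (∑ℚ f n) (∑ℚ g n) (f n) (g n))

∑-suc : ∀ f n → ∑ℚ f (suc n) ≡ f 0 ℚ.+ ∑ℚ (f ∘ suc) n
∑-suc f zero    = ℚ.+-comm 0ℚ (f 0)
∑-suc f (suc n) = trans (cong (ℚ._+ f (suc n)) (∑-suc f n)) (ℚ.+-assoc (f 0) _ _)

∑-shift : ∀ f m n → ∑ℚ f (m ℕ.+ n) ≡ ∑ℚ f m ℚ.+ ∑ℚ (f ∘ (m ℕ.+_)) n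
∑-shift f m zero rewrite ℕ.+-identityʳ m = sym (ℚ.+-identityʳ _)
∑-shift f m (suc n) rewrite ℕ.+-suc m n =
  trans (cong (ℚ._+ f (m ℕ.+ n)) (∑-shift f m n)) (ℚ.+-assoc (∑ℚ f m) _ _)

0≤∑ : ∀ {f} → (∀ k → 0ℚ ℚ.≤ f k) → ∀ n → 0ℚ ℚ.≤ ∑ℚ f n
0≤∑ {f} 0≤f n = subst (ℚ._≤ ∑ℚ f n) (∑-0 n) (∑-mono 0≤f n)

∑-monoʳ : ∀ {f} → (∀ k → 0ℚ ℚ.≤ f k) → ∀ {m n} → m ℕ.≤ n → ∑ℚ f m ℚ.≤ ∑ℚ f n
∑-monoʳ {f} 0≤f {m} {n} m≤n with ℕ.m≤n⇒∃[o]m+o≡n m≤n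
... | o , refl = ≤-by _ (0≤∑ (0≤f ∘ (m ℕ.+_)) o) (∑-shift f m o)

-- Serves both for the scale factors of the inverse branches and for distributing ε over countably
-- many stages.
∑½^[1+k]≤1 : ∀ n → ∑ℚ (λ k → ½ ^ suc k) n ℚ.≤ 1ℚ
∑½^[1+k]≤1 n = ≤-by (½ ^ n) (0≤½^p n) (sym (closed-form n))
  where
  closed-form : ∀ n → ∑ℚ (λ k → ½ ^ suc k) n ℚ.+ ½ ^ n ≡ 1ℚ
  closed-form zero    = refl
  closed-form (suc n) = trans
    (solve 2 (λ s h → s :+ con ½ :* h :+ con ½ :* h := s :+ h) refl (∑ℚ (λ k → ½ ^ suc k) n) (½ ^ n))
    (closed-form n)

fromℕ-suc : ∀ n → + suc n / 1 ≡ + n / 1 ℚ.+ 1ℚ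
fromℕ-suc n = ℚ.toℚᵘ-injective (begin
  ℚ.toℚᵘ (+ suc n / 1)               ≈⟨ ℚ.toℚᵘ-fromℚᵘ (mkℚᵘ (+ suc n) 0) ⟩
  mkℚᵘ (+ suc n) 0                   ≈⟨ ℚᵘ.*≡* (cong (ℤ._* + 1) suc≡) ⟩
  mkℚᵘ (+ n) 0 ℚᵘ.+ ℚ.toℚᵘ 1ℚ        ≈⟨ ℚᵘ.+-congˡ (ℚ.toℚᵘ 1ℚ) (ℚ.toℚᵘ-fromℚᵘ (mkℚᵘ (+ n) 0)) ⟨
  ℚ.toℚᵘ (+ n / 1) ℚᵘ.+ ℚ.toℚᵘ 1ℚ    ≈⟨ ℚ.toℚᵘ-homo-+ (+ n / 1) 1ℚ ⟨
  ℚ.toℚᵘ (+ n / 1 ℚ.+ 1ℚ)            ∎)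
  where
  open ℚᵘ.≃-Reasoning
  suc≡ : + suc n ≡ + n ℤ.* + 1 ℤ.+ + 1
  suc≡ = trans (cong +_ (ℕ.+-comm 1 n)) (cong (ℤ._+ + 1) (sym (ℤ.*-identityʳ (+ n))))

-- The multiple nε is written as a constant sum because later inductions add one ε at a time.
archimedean : ∀ {ε} → 0ℚ ℚ.< ε → ∀ b → ∃[ n ] b ℚ.≤ ∑ℚ (λ _ → ε) n
archimedean {ε} 0<ε b = n , (begin
  b                    ≡⟨ sym (ℚ.*-identityʳ b) ⟩
  b ℚ.* 1ℚ             ≡⟨ cong (b ℚ.*_) (sym (ℚ.*-inverseˡ ε)) ⟩
  b ℚ.* (ε⁻¹ ℚ.* ε)    ≡⟨ sym (ℚ.*-assoc b ε⁻¹ ε) ⟩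
  (b ℚ.* ε⁻¹) ℚ.* ε    ≤⟨ ℚ.*-monoʳ-≤-nonNeg ε b/ε≤n ⟩
  (+ n / 1) ℚ.* ε      ≡⟨ sym (∑-const n) ⟩
  ∑ℚ (λ _ → ε) n       ∎)
  where
  open ℚ.≤-Reasoning
  instance
    ε-pos = ℚ.positive 0<ε
    ε-nonNeg = ℚ.nonNegative (ℚ.<⇒≤ 0<ε)
    ε-nonZero = ℚ.pos⇒nonZero ε
  ε⁻¹ = ℚ.1/ ε
  n = proj₁ (above-natural (b ℚ.* ε⁻¹))
  b/ε≤n = proj₂ (above-natural (b ℚ.* ε⁻¹))
  ∑-const : ∀ n → ∑ℚ (λ _ → ε) n ≡ (+ n / 1) ℚ.* ε
  ∑-const zero    = sym (ℚ.*-zeroˡ ε)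
  ∑-const (suc n) = trans (cong (ℚ._+ ε) (∑-const n)) (trans
    (solve 2 (λ p ε → p :* ε :+ ε := (p :+ con 1ℚ) :* ε) refl (+ n / 1) ε)
    (cong (ℚ._* ε) (sym (fromℕ-suc n))))

½^-small : ∀ {ε} → 0ℚ ℚ.< ε → ∃[ n ] ½ ^ n ℚ.≤ ε
½^-small {ε} 0<ε = n ,
  ℚ.≤-trans (subst (ℚ._≤ ½ ^ n ℚ.* nε n) (ℚ.*-identityʳ (½ ^ n)) (*-monoˡ-≤ (0≤½^p n) 1≤nε)) (bound n)
  where
  nε = ∑ℚ (λ _ → ε)
  n = proj₁ (archimedean 0<ε 1ℚ)
  1≤nε = proj₂ (archimedean 0<ε 1ℚ)
  -- This is n·2^(-n) ≤ 1 scaled by ε; as nε ≥ 1 for the chosen n, it bounds 2^(-n) itself.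
  bound : ∀ n → ½ ^ n ℚ.* nε n ℚ.≤ ε
  bound zero    = ℚ.<⇒≤ 0<ε
  bound (suc n) = begin
    ½ ℚ.* ½ ^ n ℚ.* (nε n ℚ.+ ε)
      ≡⟨ solve 3 (λ h s e → con ½ :* h :* (s :+ e) := con ½ :* (h :* s :+ h :* e)) refl (½ ^ n) (nε n) ε ⟩
    ½ ℚ.* (½ ^ n ℚ.* nε n ℚ.+ ½ ^ n ℚ.* ε)
      ≤⟨ *-monoˡ-≤ 0≤½ (ℚ.+-mono-≤ (bound n) (ℚ.*-monoʳ-≤-nonNeg ε {{ℚ.nonNegative (ℚ.<⇒≤ 0<ε)}} (½^p≤1 n))) ⟩
    ½ ℚ.* (ε ℚ.+ 1ℚ ℚ.* ε)
      ≡⟨ solve 1 (λ e → con ½ :* (e :+ con 1ℚ :* e) := e) refl ε ⟩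
    ε ∎
    where open ℚ.≤-Reasoning

-- Countable unions of covers

halve : ℕ → ℕ ⊎ ℕ
halve zero          = inj₁ zero
halve (suc zero)    = inj₂ zero
halve (suc (suc n)) = Sum.map suc suc (halve n)

halve-even : ∀ n → halve (n ℕ.+ n) ≡ inj₁ n
halve-even zero = refl
halve-even (suc n) rewrite ℕ.+-suc n n | halve-even n = refl

halve-odd : ∀ n → halve (suc (n ℕ.+ n)) ≡ inj₂ n
halve-odd zero = refl
halve-odd (suc n) rewrite ℕ.+-suc n n | halve-odd n = refl

∑-halve : ∀ (f : ℕ ⊎ ℕ → ℚ) n →
  ∑ℚ (f ∘ halve) (n ℕ.+ n) ≡ ∑ℚ (f ∘ inj₁) n ℚ.+ ∑ℚ (f ∘ inj₂) n
∑-halve f zero = refl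
∑-halve f (suc n) rewrite ℕ.+-suc n n | halve-even n | halve-odd n | ∑-halve f n =
  solve 4 (λ a b c d → a :+ b :+ c :+ d := (a :+ c) :+ (b :+ d)) refl
    (∑ℚ (f ∘ inj₁) n) (∑ℚ (f ∘ inj₂) n) (f (inj₁ n)) (f (inj₂ n))

0≤length : ∀ I → 0ℚ ℚ.≤ length I
0≤length I = p≤q⇒0≤q-p (left≤right I)

total : (ℕ → OpenInterval) → ℕ → ℚ
total I = ∑ℚ (λ k → length (I k))

empty : OpenInterval
empty = record { left = 0ℚ ; right = 0ℚ ; left≤right = ℚ.≤-refl }

total-empty : ∀ n → total (λ _ → empty) n ≡ 0ℚ
total-empty = ∑-0

-- interleave f I lists the first f of the sequences I 0, I 1, …, with I i j at
-- position 2^i (2j + 1) - 1.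
interleave : ℕ → (ℕ → ℕ → OpenInterval) → ℕ → OpenInterval
interleave zero    I k = empty
interleave (suc f) I k = Sum.[ I 0 , interleave f (I ∘ suc) ] (halve k)

position : ℕ → ℕ → ℕ
position zero    j = j ℕ.+ j
position (suc i) j = suc (position i j ℕ.+ position i j)

-- `suc k` is fuel: by `i≤position` no entry of `I i` comes before index i, so index k needs only
-- the first `suc k` sequences.
flatten : (ℕ → ℕ → OpenInterval) → ℕ → OpenInterval
flatten I k = interleave (suc k) I k

interleave-position : ∀ {f} I {i} j → i ℕ.< f → interleave f I (position i j) ≡ I i j
interleave-position {suc f} I {zero} j _ rewrite halve-even j = refl
interleave-position {suc f} I {suc i} j (ℕ.s≤s i<f) rewrite halve-odd (position i j) =
  interleave-position (I ∘ suc) j i<f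

i≤position : ∀ i j → i ℕ.≤ position i j
i≤position zero    j = ℕ.z≤n
i≤position (suc i) j = ℕ.s≤s (ℕ.≤-trans (i≤position i j) (ℕ.m≤m+n _ _))

flatten-position : ∀ I i j → flatten I (position i j) ≡ I i j
flatten-position I i j = interleave-position I j (ℕ.s≤s (i≤position i j))

-- More fuel only replaces empty intervals. This brings the index-dependent fuel of `flatten` to a
-- common value.
interleave-mono : ∀ {f g} → f ℕ.≤ g → ∀ I k →
  length (interleave f I k) ℚ.≤ length (interleave g I k)
interleave-mono {g = g} ℕ.z≤n I k = 0≤length (interleave g I k)
interleave-mono {suc f} {suc g} (ℕ.s≤s f≤g) I k = mono (halve k)
  where
  mono : ∀ k → length (Sum.[ I 0 , interleave f (I ∘ suc) ] k) ℚ.≤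
    length (Sum.[ I 0 , interleave g (I ∘ suc) ] k)
  mono (inj₁ k) = ℚ.≤-refl
  mono (inj₂ k) = interleave-mono f≤g (I ∘ suc) k

n≤2^n : ∀ n → n ℕ.≤ 2 ℕ.^ n
n≤2^n zero    = ℕ.z≤n
n≤2^n (suc n) rewrite ℕ.+-identityʳ (2 ℕ.^ n) = ℕ.+-mono-≤ (ℕ.m^n>0 2 n) (n≤2^n n)

-- A range of 2^f indices splits evenly at each level of the interleaving, which lets the induction
-- on f close.
total-interleave : ∀ f I t → (∀ i n → total (I i) n ℚ.≤ t i) →
  total (interleave f I) (2 ℕ.^ f) ℚ.≤ ∑ℚ t f
total-interleave zero I t total≤ = ℚ.≤-refl
total-interleave (suc f) I t total≤ rewrite ℕ.+-identityʳ (2 ℕ.^ f) = begin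
  total (interleave (suc f) I) (2 ℕ.^ f ℕ.+ 2 ℕ.^ f)
    ≡⟨ ∑-halve (λ k → length (Sum.[ I 0 , interleave f (I ∘ suc) ] k)) (2 ℕ.^ f) ⟩
  total (I 0) (2 ℕ.^ f) ℚ.+ total (interleave f (I ∘ suc)) (2 ℕ.^ f)
    ≤⟨ ℚ.+-mono-≤ (total≤ 0 (2 ℕ.^ f)) (total-interleave f (I ∘ suc) (t ∘ suc) (total≤ ∘ suc)) ⟩
  t 0 ℚ.+ ∑ℚ (t ∘ suc) f
    ≡⟨ sym (∑-suc t f) ⟩
  ∑ℚ t (suc f) ∎
  where open ℚ.≤-Reasoning

total-flatten : ∀ {I t T} → (∀ i n → total (I i) n ℚ.≤ t i) → (∀ n → ∑ℚ t n ℚ.≤ T) →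
  ∀ n → total (flatten I) n ℚ.≤ T
total-flatten {I} {t} {T} total≤ ∑t≤T n = begin
  total (flatten I) n               ≤⟨ ∑-mono-< n (λ {k} k<n → interleave-mono k<n I k) ⟩
  total (interleave n I) n          ≤⟨ ∑-monoʳ (λ k → 0≤length (interleave n I k)) (n≤2^n n) ⟩
  total (interleave n I) (2 ℕ.^ n)  ≤⟨ total-interleave n I t total≤ ⟩
  ∑ℚ t n                            ≤⟨ ∑t≤T n ⟩
  T                                 ∎
  where open ℚ.≤-Reasoning

-- Abstract in the points, so that it serves digit sequences (`Seq`) as well as reals (`Real`, where
-- `Covering` unfolds to `CoverTotal`).
module Coverings {ℓ} {X : Set ℓ} (_∈ₓ_ : X → OpenInterval → Set) where

  Covering : (X → Set) → ℚ → Set ℓ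
  Covering A t = ∃[ I ] ((∀ x → A x → ∃[ k ] x ∈ₓ I k) × (∀ n → total I n ℚ.≤ t))

  Covering-⊆ : ∀ {A B : X → Set} {t} → (∀ {x} → A x → B x) → Covering B t → Covering A t
  Covering-⊆ A⊆B (I , covers , total≤) = I , (λ x x∈A → covers x (A⊆B x∈A)) , total≤

  Covering-≤ : ∀ {A : X → Set} {s t} → s ℚ.≤ t → Covering A s → Covering A t
  Covering-≤ s≤t (I , covers , total≤) = I , covers , λ n → ℚ.≤-trans (total≤ n) s≤t

  Covering-⋃ : ∀ {A : ℕ → X → Set} {t T} → (∀ i → Covering (A i) (t i)) → (∀ n → ∑ℚ t n ℚ.≤ T) →
    Covering (λ x → ∃[ i ] A i x) T
  Covering-⋃ {A} cov ∑t≤T = flatten I , covers , total-flatten {I} (proj₂ ∘ proj₂ ∘ cov) ∑t≤T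
    where
    I : ℕ → ℕ → OpenInterval
    I = proj₁ ∘ cov
    covers : ∀ x → ∃[ i ] A i x → ∃[ k ] x ∈ₓ flatten I k
    covers x (i , x∈A) =
      let j , x∈I = proj₁ (proj₂ (cov i)) x x∈A
      in position i j , subst (x ∈ₓ_) (sym (flatten-position I i j)) x∈I

  Covering-∪ : ∀ {A B : X → Set} {s t} → Covering A s → Covering B t → Covering (λ x → A x ⊎ B x) (s ℚ.+ t)
  Covering-∪ {A} {B} {s} {t} (I , I-covers , I≤) (J , J-covers , J≤) = K ∘ halve , covers , total≤
    where
    K : ℕ ⊎ ℕ → OpenInterval
    K = Sum.[ I , J ]
    covers : ∀ x → A x ⊎ B x → ∃[ k ] x ∈ₓ K (halve k)
    covers x (inj₁ x∈A) =
      let j , x∈I = I-covers x x∈A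
      in j ℕ.+ j , subst (λ k → x ∈ₓ K k) (sym (halve-even j)) x∈I
    covers x (inj₂ x∈B) =
      let j , x∈J = J-covers x x∈B
      in suc (j ℕ.+ j) , subst (λ k → x ∈ₓ K k) (sym (halve-odd j)) x∈J
    total≤ : ∀ n → total (K ∘ halve) n ℚ.≤ s ℚ.+ t
    total≤ n = begin
      total (K ∘ halve) n            ≤⟨ ∑-monoʳ (λ k → 0≤length (K (halve k))) (ℕ.m≤m+n n n) ⟩
      total (K ∘ halve) (n ℕ.+ n)    ≡⟨ ∑-halve (length ∘ K) n ⟩
      total I n ℚ.+ total J n        ≤⟨ ℚ.+-mono-≤ (I≤ n) (J≤ n) ⟩
      s ℚ.+ t                        ∎
      where open ℚ.≤-Reasoning

  Covering-≥0 : ∀ {A : X → Set} {t} → Covering A t → 0ℚ ℚ.≤ t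
  Covering-≥0 (_ , _ , total≤) = total≤ 0

  Covering-single : ∀ {A : X → Set} I → (∀ x → A x → x ∈ₓ I) → Covering A (length I)
  Covering-single {A} I A⊆I = J , (λ x x∈A → 0 , A⊆I x x∈A) , total≤
    where
    J : ℕ → OpenInterval
    J zero    = I
    J (suc _) = empty
    total≤ : ∀ n → total J n ℚ.≤ length I
    total≤ zero    = 0≤length I
    total≤ (suc n) = ℚ.≤-reflexive (trans (∑-suc (length ∘ J) n)
      (trans (cong (length I ℚ.+_) (total-empty n)) (ℚ.+-identityʳ (length I))))

-- Covering sets of digit sequences

partialSum : (ℕ → ℕ) → ℕ → ℚ
partialSum d = ∑ℚ (λ i → ½ ^ digitSum d i)

Positive : (ℕ → ℕ) → Set
Positive d = ∀ i → 1 ℕ.≤ d i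

digitSum-suc : ∀ d i → digitSum d (suc i) ≡ d 0 ℕ.+ digitSum (d ∘ suc) i
digitSum-suc d zero    = refl
digitSum-suc d (suc i) =
  trans (cong (ℕ._+ d (suc (suc i))) (digitSum-suc d i)) (ℕ.+-assoc (d 0) _ _)

-- On partial sums, prepending a digit m acts as the inverse branch y ↦ 2^(-m) (1 + y).
partialSum-suc : ∀ d n → partialSum d (suc n) ≡ ½ ^ d 0 ℚ.* (1ℚ ℚ.+ partialSum (d ∘ suc) n)
partialSum-suc d n = begin
  partialSum d (suc n)
    ≡⟨ ∑-suc (λ i → ½ ^ digitSum d i) n ⟩
  ½ ^ d 0 ℚ.+ ∑ℚ (λ i → ½ ^ digitSum d (suc i)) n
    ≡⟨ cong (½ ^ d 0 ℚ.+_) (∑-cong (λ i → trans (cong (½ ^_) (digitSum-suc d i)) (½^-+ (d 0) _)) n) ⟩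
  ½ ^ d 0 ℚ.+ ∑ℚ (λ i → ½ ^ d 0 ℚ.* ½ ^ digitSum (d ∘ suc) i) n
    ≡⟨ cong (½ ^ d 0 ℚ.+_) (∑-* (½ ^ d 0) (λ i → ½ ^ digitSum (d ∘ suc) i) n) ⟩
  ½ ^ d 0 ℚ.+ ½ ^ d 0 ℚ.* partialSum (d ∘ suc) n
    ≡⟨ solve 2 (λ h s → h :+ h :* s := h :* (con 1ℚ :+ s)) refl (½ ^ d 0) (partialSum (d ∘ suc) n) ⟩
  ½ ^ d 0 ℚ.* (1ℚ ℚ.+ partialSum (d ∘ suc) n) ∎
  where open ≡-Reasoning

0≤partialSum : ∀ d n → 0ℚ ℚ.≤ partialSum d n
0≤partialSum d = 0≤∑ (λ i → 0≤½^p (digitSum d i))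

partialSum≤1 : ∀ {d} → Positive d → ∀ n → partialSum d n ℚ.≤ 1ℚ
partialSum≤1 pos zero = 0≤1
partialSum≤1 {d} pos (suc n) = begin
  partialSum d (suc n)
    ≡⟨ partialSum-suc d n ⟩
  ½ ^ d 0 ℚ.* (1ℚ ℚ.+ partialSum (d ∘ suc) n)
    ≤⟨ *-monoˡ-≤ (0≤½^p (d 0)) (ℚ.+-monoʳ-≤ 1ℚ (partialSum≤1 (pos ∘ suc) n)) ⟩
  ½ ^ d 0 ℚ.* (1ℚ ℚ.+ 1ℚ)
    ≤⟨ ℚ.*-monoʳ-≤-nonNeg (1ℚ ℚ.+ 1ℚ) (½^-antimono (pos 0)) ⟩
  1ℚ ∎
  where open ℚ.≤-Reasoning

-- The margin η keeps the limit of the partial sums off the endpoints, so that it lies in the open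
-- interval.
Inside : (ℕ → ℕ) → OpenInterval → Set
Inside d I = ∃[ η ] (0ℚ ℚ.< η × ∃[ N ] ∀ n → N ℕ.≤ n →
  (left I ℚ.+ η ℚ.≤ partialSum d n × partialSum d n ℚ.≤ right I ℚ.- η))

module Seq = Coverings Inside

SeqCovering : ((ℕ → ℕ) → Set) → ℚ → Set
SeqCovering P = Seq.Covering (λ d → Positive d × P d)

SeqCovering-⊆ : ∀ {P Q t} → (∀ {d} → Positive d → P d → Q d) → SeqCovering Q t → SeqCovering P t
SeqCovering-⊆ P⊆Q = Seq.Covering-⊆ (λ (pos , p) → pos , P⊆Q pos p)

SeqCovering-⋃ : ∀ {P : ℕ → (ℕ → ℕ) → Set} {t T} → (∀ i → SeqCovering (P i) (t i)) →
  (∀ n → ∑ℚ t n ℚ.≤ T) → SeqCovering (λ d → ∃[ i ] P i d) T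
SeqCovering-⋃ cov ∑t≤T = Seq.Covering-⊆ (λ (pos , i , p) → i , pos , p) (Seq.Covering-⋃ cov ∑t≤T)

SeqCovering-∪ : ∀ {P Q : (ℕ → ℕ) → Set} {s t} → SeqCovering P s → SeqCovering Q t →
  SeqCovering (λ d → P d ⊎ Q d) (s ℚ.+ t)
SeqCovering-∪ covP covQ =
  Seq.Covering-⊆ (λ (pos , p⊎q) → Sum.map (pos ,_) (pos ,_) p⊎q) (Seq.Covering-∪ covP covQ)

-- The image of an interval under the inverse branch y ↦ 2^(-m) (1 + y) of T.
branch : ℕ → OpenInterval → OpenInterval
branch m I = record
  { left       = ½ ^ m ℚ.* (1ℚ ℚ.+ left I)
  ; right      = ½ ^ m ℚ.* (1ℚ ℚ.+ right I)
  ; left≤right = *-monoˡ-≤ (0≤½^p m) (ℚ.+-monoʳ-≤ 1ℚ (left≤right I))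
  }

length-branch : ∀ m I → length (branch m I) ≡ ½ ^ m ℚ.* length I
length-branch m I =
  solve 3 (λ h l r → h :* (con 1ℚ :+ r) :- h :* (con 1ℚ :+ l) := h :* (r :- l)) refl
    (½ ^ m) (left I) (right I)

Inside-branch : ∀ {d I} → Inside (d ∘ suc) I → Inside d (branch (d 0) I)
Inside-branch {d} {I} (η , 0<η , N , inside) = h ℚ.* η , 0<p*q (0<½^n (d 0)) 0<η , suc N , inside′
  where
  h = ½ ^ d 0
  inside′ : ∀ n → suc N ℕ.≤ n →
    (left (branch (d 0) I) ℚ.+ h ℚ.* η ℚ.≤ partialSum d n ×
     partialSum d n ℚ.≤ right (branch (d 0) I) ℚ.- h ℚ.* η)
  inside′ (suc n) (ℕ.s≤s N≤n) =
    let lower , upper = inside n N≤n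
        s = partialSum (d ∘ suc) n
    in (begin
         h ℚ.* (1ℚ ℚ.+ left I) ℚ.+ h ℚ.* η
           ≡⟨ solve 3 (λ h l e → h :* (con 1ℚ :+ l) :+ h :* e := h :* (con 1ℚ :+ (l :+ e)))
               refl h (left I) η ⟩
         h ℚ.* (1ℚ ℚ.+ (left I ℚ.+ η))
           ≤⟨ *-monoˡ-≤ (0≤½^p (d 0)) (ℚ.+-monoʳ-≤ 1ℚ lower) ⟩
         h ℚ.* (1ℚ ℚ.+ s)
           ≡⟨ sym (partialSum-suc d n) ⟩
         partialSum d (suc n) ∎)
     , (begin
         partialSum d (suc n)
           ≡⟨ partialSum-suc d n ⟩
         h ℚ.* (1ℚ ℚ.+ s)
           ≤⟨ *-monoˡ-≤ (0≤½^p (d 0)) (ℚ.+-monoʳ-≤ 1ℚ upper) ⟩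
         h ℚ.* (1ℚ ℚ.+ (right I ℚ.- η))
           ≡⟨ solve 3 (λ h r e → h :* (con 1ℚ :+ (r :- e)) := h :* (con 1ℚ :+ r) :- h :* e)
               refl h (right I) η ⟩
         h ℚ.* (1ℚ ℚ.+ right I) ℚ.- h ℚ.* η ∎)
    where open ℚ.≤-Reasoning

SeqCovering-prepend : ∀ {P t} m → SeqCovering P t →
  SeqCovering (λ d → d 0 ≡ m × P (d ∘ suc)) (½ ^ m ℚ.* t)
SeqCovering-prepend {P} {t} m (I , covers , total≤) = branch m ∘ I , covers′ , total≤′
  where
  covers′ : ∀ d → Positive d × d 0 ≡ m × P (d ∘ suc) → ∃[ k ] Inside d (branch m (I k))
  covers′ d (pos , refl , p) =
    let k , inside = covers (d ∘ suc) (pos ∘ suc , p)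
    in k , Inside-branch {d} {I k} inside
  total≤′ : ∀ n → total (branch m ∘ I) n ℚ.≤ ½ ^ m ℚ.* t
  total≤′ n = begin
    total (branch m ∘ I) n                      ≡⟨ ∑-cong (length-branch m ∘ I) n ⟩
    ∑ℚ (λ k → ½ ^ m ℚ.* length (I k)) n         ≡⟨ ∑-* (½ ^ m) (length ∘ I) n ⟩
    ½ ^ m ℚ.* total I n                         ≤⟨ *-monoˡ-≤ (0≤½^p m) (total≤ n) ⟩
    ½ ^ m ℚ.* t                                 ∎
    where open ℚ.≤-Reasoning

-- The new set is the preimage under T, a union of one image per inverse branch. This is the
-- upper-bound half of the invariance of Lebesgue measure under T.
SeqCovering-tail : ∀ {P t} → SeqCovering P t → SeqCovering (λ d → P (d ∘ suc)) t
SeqCovering-tail {P} {t} cov = SeqCovering-⊆ first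
  (SeqCovering-⋃ (λ i → SeqCovering-prepend (suc i) cov) ∑≤t)
  where
  first : ∀ {d} → Positive d → P (d ∘ suc) → ∃[ i ] (d 0 ≡ suc i × P (d ∘ suc))
  first {d} pos p = ℕ.pred (d 0) , sym (ℕ.suc-pred (d 0) {{ℕ.>-nonZero (pos 0)}}) , p
  ∑≤t : ∀ n → ∑ℚ (λ i → ½ ^ suc i ℚ.* t) n ℚ.≤ t
  ∑≤t n = begin
    ∑ℚ (λ i → ½ ^ suc i ℚ.* t) n    ≡⟨ ∑-cong (λ i → ℚ.*-comm (½ ^ suc i) t) n ⟩
    ∑ℚ (λ i → t ℚ.* ½ ^ suc i) n    ≡⟨ ∑-* t (λ i → ½ ^ suc i) n ⟩
    t ℚ.* ∑ℚ (λ i → ½ ^ suc i) n    ≤⟨ *-monoˡ-≤ (proj₂ (proj₂ cov) 0) (∑½^[1+k]≤1 n) ⟩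
    t ℚ.* 1ℚ                        ≡⟨ ℚ.*-identityʳ t ⟩
    t                               ∎
    where open ℚ.≤-Reasoning

SeqCovering-drop : ∀ {P t} n → SeqCovering P t → SeqCovering (λ d → P (d ∘ (n ℕ.+_))) t
SeqCovering-drop zero    cov = cov
SeqCovering-drop (suc n) cov = SeqCovering-tail (SeqCovering-drop n cov)

-- Only the branches 1, ..., e occur, and their factors add up to 1 - 2^(-e). For e = 0 the set is
-- empty because digits are at least 1.
SeqCovering-bounded : ∀ {P t} e → SeqCovering P t →
  SeqCovering (λ d → d 0 ℕ.≤ e × P (d ∘ suc)) ((1ℚ ℚ.- ½ ^ e) ℚ.* t)
SeqCovering-bounded {P} {t} zero cov = Seq.Covering-≤
  (ℚ.≤-reflexive (trans (ℚ.*-zeroˡ t) (sym (ℚ.*-zeroˡ t))))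
  ((λ _ → empty) , (λ d (pos , d₀≤0 , _) → ⊥-elim (ℕ.<-irrefl refl (ℕ.≤-trans (pos 0) d₀≤0)))
    , λ n → ℚ.≤-reflexive (trans (total-empty n) (sym (ℚ.*-zeroˡ t))))
SeqCovering-bounded {P} {t} (suc e) cov = Seq.Covering-≤
  (ℚ.≤-reflexive (solve 2 (λ h t → (con 1ℚ :- h) :* t :+ (con ½ :* h) :* t := (con 1ℚ :- con ½ :* h) :* t)
      refl (½ ^ e) t))
  (SeqCovering-⊆ split (SeqCovering-∪ (SeqCovering-bounded e cov) (SeqCovering-prepend (suc e) cov)))
  where
  split : ∀ {d} → Positive d → d 0 ℕ.≤ suc e × P (d ∘ suc) →
    (d 0 ℕ.≤ e × P (d ∘ suc)) ⊎ (d 0 ≡ suc e × P (d ∘ suc))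
  split _ (d₀≤1+e , p) with ℕ.m≤n⇒m<n∨m≡n d₀≤1+e
  ... | inj₁ d₀<1+e = inj₁ (ℕ.≤-pred d₀<1+e , p)
  ... | inj₂ d₀≡1+e = inj₂ (d₀≡1+e , p)

-- All x with d_1(x) > e lie in (0, 2^(-e)]; the interval is taken twice as
-- long to make it open.
SeqCovering-large : ∀ e → SeqCovering (λ d → e ℕ.< d 0) ((1ℚ ℚ.+ 1ℚ) ℚ.* ½ ^ e)
SeqCovering-large e = Seq.Covering-≤ (ℚ.≤-reflexive (ℚ.+-identityʳ _)) (Seq.Covering-single I inside)
  where
  2h = (1ℚ ℚ.+ 1ℚ) ℚ.* ½ ^ e
  I : OpenInterval
  I = record { left = 0ℚ ; right = 2h ; left≤right = 0≤p*q (ℚ.nonNegative⁻¹ (1ℚ ℚ.+ 1ℚ)) (0≤½^p e) }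
  inside : ∀ d → Positive d × e ℕ.< d 0 → Inside d I
  inside d (pos , e<d₀) = h , 0<½^n (d 0) , 1 , bounds
    where
    open ℚ.≤-Reasoning
    h = ½ ^ d 0
    -- With u = 2^(-e) the claim 2h ≤ 2u - h means 3h ≤ 2u. It holds because h ≤ u/2, and 2u - 3h =
    -- 3(u/2 - h) + u/2.
    3ℚ = + 3 / 1
    0≤slack : 0ℚ ℚ.≤ 3ℚ ℚ.* (½ ^ suc e ℚ.- h) ℚ.+ ½ ^ suc e
    0≤slack = ℚ.+-mono-≤ (0≤p*q (ℚ.nonNegative⁻¹ 3ℚ) (p≤q⇒0≤q-p (½^-antimono e<d₀))) (0≤½^p (suc e))
    slack≡ : 2h ℚ.- h ≡ h ℚ.* (1ℚ ℚ.+ 1ℚ) ℚ.+ (3ℚ ℚ.* (½ ^ suc e ℚ.- h) ℚ.+ ½ ^ suc e)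
    slack≡ = solve 2 (λ u h → con (1ℚ ℚ.+ 1ℚ) :* u :- h := h :* con (1ℚ ℚ.+ 1ℚ) :+ (con 3ℚ :* (con ½ :* u :- h) :+ con ½ :* u))
        refl (½ ^ e) h
    bounds : ∀ n → 1 ℕ.≤ n → (0ℚ ℚ.+ h ℚ.≤ partialSum d n × partialSum d n ℚ.≤ 2h ℚ.- h)
    bounds (suc n) _ =
        (begin
          0ℚ ℚ.+ h                                      ≡⟨ ℚ.+-identityˡ h ⟩
          h                                             ≡⟨ sym (ℚ.*-identityʳ h) ⟩
          h ℚ.* 1ℚ
            ≤⟨ *-monoˡ-≤ (0≤½^p (d 0)) (≤-by _ (0≤partialSum (d ∘ suc) n) refl) ⟩
          h ℚ.* (1ℚ ℚ.+ partialSum (d ∘ suc) n)         ≡⟨ sym (partialSum-suc d n) ⟩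
          partialSum d (suc n)                          ∎)
      , (begin
          partialSum d (suc n)                          ≡⟨ partialSum-suc d n ⟩
          h ℚ.* (1ℚ ℚ.+ partialSum (d ∘ suc) n)
            ≤⟨ *-monoˡ-≤ (0≤½^p (d 0)) (ℚ.+-monoʳ-≤ 1ℚ (partialSum≤1 (pos ∘ suc) n)) ⟩
          h ℚ.* (1ℚ ℚ.+ 1ℚ)
            ≤⟨ ≤-by (3ℚ ℚ.* (½ ^ suc e ℚ.- h) ℚ.+ ½ ^ suc e) 0≤slack slack≡ ⟩
          2h ℚ.- h                                      ∎)

prodAvoid : (ℕ → ℕ) → ℕ → ℚ
prodAvoid e zero    = 1ℚ
prodAvoid e (suc m) = (1ℚ ℚ.- ½ ^ e 0) ℚ.* prodAvoid (e ∘ suc) m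

SeqCovering-avoid : ∀ e m →
  SeqCovering (λ d → ∀ n → n ℕ.< m → d n ℕ.≤ e n) ((1ℚ ℚ.+ 1ℚ) ℚ.* prodAvoid e m)
-- With no digit constrained, d 0 > 0 always holds, and the interval (0, 2) gives the factor 2.
SeqCovering-avoid e zero = SeqCovering-⊆ (λ pos _ → pos 0) (SeqCovering-large 0)
SeqCovering-avoid e (suc m) = Seq.Covering-≤
  (ℚ.≤-reflexive (solve 2 (λ a p → a :* (con (1ℚ ℚ.+ 1ℚ) :* p) := con (1ℚ ℚ.+ 1ℚ) :* (a :* p))
      refl (1ℚ ℚ.- ½ ^ e 0) (prodAvoid (e ∘ suc) m)))
  (SeqCovering-⊆ (λ _ avoid → avoid 0 (ℕ.s≤s ℕ.z≤n) , λ n n<m → avoid (suc n) (ℕ.s≤s n<m))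
    (SeqCovering-bounded (e 0) (SeqCovering-avoid (e ∘ suc) m)))

-- Borel–Cantelli for digit sequences

0<ε/2 : ∀ {ε} → 0ℚ ℚ.< ε → 0ℚ ℚ.< ½ ℚ.* ε
0<ε/2 = 0<p*q 0<½

SeqNull : ((ℕ → ℕ) → Set) → Set
SeqNull P = ∀ ε → 0ℚ ℚ.< ε → SeqCovering P ε

prodAvoid-nonNeg : ∀ e m → 0ℚ ℚ.≤ prodAvoid e m
prodAvoid-nonNeg e zero    = 0≤1
prodAvoid-nonNeg e (suc m) = 0≤p*q (p≤q⇒0≤q-p (½^p≤1 (e 0))) (prodAvoid-nonNeg (e ∘ suc) m)

-- A rational counterpart of 1 - w ≤ exp(-w): a new factor 1 - w together with a new summand w
-- lowers P(1 + S) by P·w·(w + S).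
prodAvoid-bound : ∀ e m → prodAvoid e m ℚ.* (1ℚ ℚ.+ ∑ℚ (λ n → ½ ^ e n) m) ℚ.≤ 1ℚ
prodAvoid-bound e zero = ℚ.≤-refl
prodAvoid-bound e (suc m) =
  ℚ.≤-trans (≤-by (P ℚ.* (w ℚ.* (w ℚ.+ S))) 0≤slack slack≡) (prodAvoid-bound (e ∘ suc) m)
  where
  P = prodAvoid (e ∘ suc) m
  S = ∑ℚ (λ n → ½ ^ e (suc n)) m
  w = ½ ^ e 0
  0≤slack : 0ℚ ℚ.≤ P ℚ.* (w ℚ.* (w ℚ.+ S))
  0≤slack = 0≤p*q (prodAvoid-nonNeg (e ∘ suc) m) (0≤p*q (0≤½^p (e 0))
    (ℚ.+-mono-≤ (0≤½^p (e 0)) (0≤∑ (λ n → 0≤½^p (e (suc n))) m)))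
  slack≡ : P ℚ.* (1ℚ ℚ.+ S) ≡
    (1ℚ ℚ.- w) ℚ.* P ℚ.* (1ℚ ℚ.+ ∑ℚ (λ n → ½ ^ e n) (suc m)) ℚ.+ P ℚ.* (w ℚ.* (w ℚ.+ S))
  slack≡ rewrite ∑-suc (λ n → ½ ^ e n) m =
    solve 3 (λ p w s → p :* (con 1ℚ :+ s) := (con 1ℚ :- w) :* p :* (con 1ℚ :+ (w :+ s)) :+ p :* (w :* (w :+ s)))
        refl P w S

Unbounded : (ℕ → ℚ) → Set
Unbounded f = ∀ b → ∃[ n ] b ℚ.≤ ∑ℚ f n

Unbounded-drop : ∀ {f} → (∀ k → 0ℚ ℚ.≤ f k) → Unbounded f → ∀ N → Unbounded (f ∘ (N ℕ.+_))
Unbounded-drop {f} 0≤f unbounded N b = n , (begin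
  b                                             ≡⟨ solve 2 (λ b s → b := (b :+ s) :- s) refl b (∑ℚ f N) ⟩
  (b ℚ.+ ∑ℚ f N) ℚ.- ∑ℚ f N
    ≤⟨ ℚ.+-monoˡ-≤ (ℚ.- ∑ℚ f N) (ℚ.≤-trans b+∑≤ (∑-monoʳ 0≤f (ℕ.m≤n+m n N))) ⟩
  ∑ℚ f (N ℕ.+ n) ℚ.- ∑ℚ f N                     ≡⟨ cong (ℚ._- ∑ℚ f N) (∑-shift f N n) ⟩
  (∑ℚ f N ℚ.+ ∑ℚ (f ∘ (N ℕ.+_)) n) ℚ.- ∑ℚ f N
    ≡⟨ solve 2 (λ s t → (s :+ t) :- s := t) refl (∑ℚ f N) (∑ℚ (f ∘ (N ℕ.+_)) n) ⟩
  ∑ℚ (f ∘ (N ℕ.+_)) n                           ∎)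
  where
  open ℚ.≤-Reasoning
  n = proj₁ (unbounded (b ℚ.+ ∑ℚ f N))
  b+∑≤ = proj₂ (unbounded (b ℚ.+ ∑ℚ f N))

prodAvoid-small : ∀ e → Unbounded (λ n → ½ ^ e n) → ∀ ε → 0ℚ ℚ.< ε → ∃[ m ] prodAvoid e m ℚ.≤ ε
prodAvoid-small e unbounded ε 0<ε = m , ℚ.≮⇒≥ ε≮P
  where
  open ℚ.≤-Reasoning
  instance
    ε-pos = ℚ.positive 0<ε
    ε-nonZero = ℚ.pos⇒nonZero ε
  m = proj₁ (unbounded (ℚ.1/ ε))
  P = prodAvoid e m
  1+S = 1ℚ ℚ.+ ∑ℚ (λ n → ½ ^ e n) m
  1/ε<1+S : ℚ.1/ ε ℚ.< 1+S
  1/ε<1+S = ℚ.≤-<-trans (proj₂ (unbounded (ℚ.1/ ε)))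
    (<-by 1ℚ (ℚ.positive⁻¹ 1ℚ) (ℚ.+-comm 1ℚ (∑ℚ (λ n → ½ ^ e n) m)))
  ε≮P : ¬ ε ℚ.< P
  ε≮P ε<P = ℚ.<-irrefl refl (begin-strict
    1ℚ              ≡⟨ sym (ℚ.*-inverseʳ ε) ⟩
    ε ℚ.* ℚ.1/ ε    <⟨ ℚ.*-monoʳ-<-pos ε 1/ε<1+S ⟩
    ε ℚ.* 1+S
      ≤⟨ ℚ.*-monoʳ-≤-nonNeg 1+S {{ℚ.nonNegative (ℚ.+-mono-≤ 0≤1 (0≤∑ (λ n → 0≤½^p (e n)) m))}} (ℚ.<⇒≤ ε<P) ⟩
    P ℚ.* 1+S       ≤⟨ prodAvoid-bound e m ⟩
    1ℚ              ∎)

-- For each N the tail of the series still diverges, so finitely many constraints from N on make the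
-- cover small; dropping the first N digits costs nothing.
SeqNull-eventually-small : ∀ (e : ℕ → ℕ) → Unbounded (λ n → ½ ^ e n) →
  SeqNull (λ d → ∃[ N ] ∀ n → N ℕ.≤ n → d n ℕ.≤ e n)
SeqNull-eventually-small e unbounded ε 0<ε = SeqCovering-⊆ (λ _ p → p) (SeqCovering-⋃ stage ∑≤ε)
  where
  stage : ∀ N → SeqCovering (λ d → ∀ n → N ℕ.≤ n → d n ℕ.≤ e n) (ε ℚ.* ½ ^ suc N)
  stage N = Seq.Covering-≤ 2P≤ (SeqCovering-⊆ (λ _ p n n<m → p (N ℕ.+ n) (ℕ.m≤m+n N n))
    (SeqCovering-drop N (SeqCovering-avoid (e ∘ (N ℕ.+_)) m)))
    where
    -- Stage N may spend ε·2^(-N-1); the half offsets the factor 2 of `SeqCovering-avoid`.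
    δ = ½ ℚ.* (ε ℚ.* ½ ^ suc N)
    small : ∃[ m ] prodAvoid (e ∘ (N ℕ.+_)) m ℚ.≤ δ
    small = prodAvoid-small (e ∘ (N ℕ.+_)) (Unbounded-drop (λ n → 0≤½^p (e n)) unbounded N)
      δ (0<ε/2 (0<p*q 0<ε (0<½^n (suc N))))
    m = proj₁ small
    2P≤ : (1ℚ ℚ.+ 1ℚ) ℚ.* prodAvoid (e ∘ (N ℕ.+_)) m ℚ.≤ ε ℚ.* ½ ^ suc N
    2P≤ = ℚ.≤-trans (*-monoˡ-≤ (ℚ.nonNegative⁻¹ (1ℚ ℚ.+ 1ℚ)) (proj₂ small))
      (ℚ.≤-reflexive (solve 1 (λ x → con (1ℚ ℚ.+ 1ℚ) :* (con ½ :* x) := x) refl (ε ℚ.* ½ ^ suc N)))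
  ∑≤ε : ∀ n → ∑ℚ (λ N → ε ℚ.* ½ ^ suc N) n ℚ.≤ ε
  ∑≤ε n = begin
    ∑ℚ (λ N → ε ℚ.* ½ ^ suc N) n    ≡⟨ ∑-* ε (λ N → ½ ^ suc N) n ⟩
    ε ℚ.* ∑ℚ (λ N → ½ ^ suc N) n    ≤⟨ *-monoˡ-≤ (ℚ.<⇒≤ 0<ε) (∑½^[1+k]≤1 n) ⟩
    ε ℚ.* 1ℚ                        ≡⟨ ℚ.*-identityʳ ε ⟩
    ε                               ∎
    where open ℚ.≤-Reasoning

SeqNull-infinitely-large : ∀ (e : ℕ → ℕ) →
  (∀ ε → 0ℚ ℚ.< ε → ∃[ N ] ∀ m → ∑ℚ (λ n → ½ ^ e (N ℕ.+ n)) m ℚ.≤ ε) →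
  SeqNull (λ d → ∀ N → ∃[ n ] (N ℕ.≤ n × e n ℕ.< d n))
SeqNull-infinitely-large e tails ε 0<ε = SeqCovering-⊆ beyond (SeqCovering-⋃ stage ∑≤ε)
  where
  N = proj₁ (tails (½ ℚ.* ε) (0<ε/2 0<ε))
  -- The index `N + i + 0` is digit 0 of the sequence shifted by `N + i`.
  stage : ∀ i → SeqCovering (λ d → e (N ℕ.+ i) ℕ.< d (N ℕ.+ i ℕ.+ 0)) ((1ℚ ℚ.+ 1ℚ) ℚ.* ½ ^ e (N ℕ.+ i))
  stage i = SeqCovering-drop (N ℕ.+ i) (SeqCovering-large (e (N ℕ.+ i)))
  beyond : ∀ {d} → Positive d → (∀ N → ∃[ n ] (N ℕ.≤ n × e n ℕ.< d n)) →
    ∃[ i ] (e (N ℕ.+ i) ℕ.< d (N ℕ.+ i ℕ.+ 0))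
  beyond {d} _ often =
    let n , N≤n , e<d = often N
        i , N+i≡n = ℕ.m≤n⇒∃[o]m+o≡n N≤n
    in i , subst (λ m → e (N ℕ.+ i) ℕ.< d m) (sym (ℕ.+-identityʳ (N ℕ.+ i)))
             (subst (λ m → e m ℕ.< d m) (sym N+i≡n) e<d)
  ∑≤ε : ∀ n → ∑ℚ (λ i → (1ℚ ℚ.+ 1ℚ) ℚ.* ½ ^ e (N ℕ.+ i)) n ℚ.≤ ε
  ∑≤ε n = begin
    ∑ℚ (λ i → (1ℚ ℚ.+ 1ℚ) ℚ.* ½ ^ e (N ℕ.+ i)) n
      ≡⟨ ∑-* (1ℚ ℚ.+ 1ℚ) (λ i → ½ ^ e (N ℕ.+ i)) n ⟩
    (1ℚ ℚ.+ 1ℚ) ℚ.* ∑ℚ (λ i → ½ ^ e (N ℕ.+ i)) n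
      ≤⟨ *-monoˡ-≤ (ℚ.nonNegative⁻¹ (1ℚ ℚ.+ 1ℚ)) (proj₂ (tails (½ ℚ.* ε) (0<ε/2 0<ε)) n) ⟩
    (1ℚ ℚ.+ 1ℚ) ℚ.* (½ ℚ.* ε)
      ≡⟨ solve 1 (λ x → con (1ℚ ℚ.+ 1ℚ) :* (con ½ :* x) := x) refl ε ⟩
    ε ∎
    where open ℚ.≤-Reasoning

-- Comparing 2^(-y) with powers of 1/2

EM : Set₂
EM = ExcludedMiddle (Level.suc 0ℓ)

decide : EM → (P : Set) → Dec P
decide em P = map′ Level.lower Level.lift (em {Level.Lift (Level.suc 0ℓ) P})

-- A downward search from n for a crossing. It supplies the thresholds e_n, the greedy digits and
-- rational approximations of cuts.
switch : ∀ {P : ℕ → Set} → (∀ n → Dec (P n)) → ¬ P 0 → ∀ n → P n → ∃[ m ] (P (suc m) × ¬ P m)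
switch P? ¬P0 zero    Pn = ⊥-elim (¬P0 Pn)
switch P? ¬P0 (suc n) Pn with P? n
... | yes Pn′ = switch P? ¬P0 n Pn′
... | no ¬Pn  = n , Pn , ¬Pn

≤-transℝ : ∀ {x y z} → x ≤ y → y ≤ z → x ≤ z
≤-transℝ x≤y y≤z q = y≤z q ∘ x≤y q

fromℚ-mono : ∀ {p q} → p ℚ.≤ q → fromℚ p ≤ fromℚ q
fromℚ-mono p≤q r r<p = ℚ.<-≤-trans r<p p≤q

fraction-mono : ∀ m n k → m ℕ.≤ n ℕ.* suc k → + m / suc k ℚ.≤ + n / 1
fraction-mono m n k m≤n[1+k] = ℚ.toℚᵘ-cancel-≤ (begin
  ℚ.toℚᵘ (+ m / suc k)    ≃⟨ ℚ.toℚᵘ-fromℚᵘ (mkℚᵘ (+ m) k) ⟩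
  mkℚᵘ (+ m) k            ≤⟨ ℚᵘ.*≤* m*1≤ ⟩
  mkℚᵘ (+ n) 0            ≃⟨ ℚ.toℚᵘ-fromℚᵘ (mkℚᵘ (+ n) 0) ⟨
  ℚ.toℚᵘ (+ n / 1)        ∎)
  where
  open ℚᵘ.≤-Reasoning
  m*1≤ : + m ℤ.* + 1 ℤ.≤ + n ℤ.* + suc k
  m*1≤ = subst₂ ℤ._≤_ (sym (ℤ.*-identityʳ (+ m))) (ℤ.pos-* n (suc k)) (ℤ.+≤+ m≤n[1+k])

fromℕ-mono : ∀ {m n} → m ℕ.≤ n → fromℕ m ≤ fromℕ n
fromℕ-mono {m} {n} m≤n = fromℚ-mono (fraction-mono m n 0 (subst (m ℕ.≤_) (sym (ℕ.*-identityʳ n)) m≤n))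

0≤^ : ∀ {q} → 0ℚ ℚ.≤ q → ∀ n → 0ℚ ℚ.≤ q ^ n
0≤^ 0≤q zero    = 0≤1
0≤^ 0≤q (suc n) = 0≤p*q 0≤q (0≤^ 0≤q n)

0<^ : ∀ {q} → 0ℚ ℚ.< q → ∀ n → 0ℚ ℚ.< q ^ n
0<^ 0<q zero    = ℚ.positive⁻¹ 1ℚ
0<^ 0<q (suc n) = 0<p*q 0<q (0<^ 0<q n)

^-monoˡ-≤ : ∀ {p q} → 0ℚ ℚ.≤ p → p ℚ.≤ q → ∀ n → p ^ n ℚ.≤ q ^ n
^-monoˡ-≤ 0≤p p≤q zero = ℚ.≤-refl
^-monoˡ-≤ {p} {q} 0≤p p≤q (suc n) = ℚ.≤-trans (*-monoˡ-≤ 0≤p (^-monoˡ-≤ 0≤p p≤q n))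
  (ℚ.*-monoʳ-≤-nonNeg (q ^ n) {{ℚ.nonNegative (0≤^ (ℚ.≤-trans 0≤p p≤q) n)}} p≤q)

½^-* : ∀ m n → (½ ^ m) ^ n ≡ ½ ^ (m ℕ.* n)
½^-* m zero rewrite ℕ.*-zeroʳ m = refl
½^-* m (suc n) rewrite ℕ.*-suc m n = trans (cong (½ ^ m ℚ.*_) (½^-* m n)) (sym (½^-+ m (m ℕ.* n)))

-- Roots are compared through their powers: s > 2^(-e) would give s^(1+k) > 2^(-e(1+k)) ≥ 2^(-p).
root-≤-½^ : ∀ {s p e k} → s ^ suc k ℚ.≤ ½ ^ p → e ℕ.* suc k ℕ.≤ p → s ℚ.≤ ½ ^ e
root-≤-½^ {s} {p} {e} {k} s^≤ e[1+k]≤p = ℚ.≮⇒≥ λ h<s → ℚ.<-irrefl refl (begin-strict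
  s ^ suc k          ≤⟨ s^≤ ⟩
  ½ ^ p              ≤⟨ ½^-antimono e[1+k]≤p ⟩
  ½ ^ (e ℕ.* suc k)  ≡⟨ sym (½^-* e (suc k)) ⟩
  h ℚ.* h ^ k        ≤⟨ *-monoˡ-≤ (0≤½^p e) (^-monoˡ-≤ (0≤½^p e) (ℚ.<⇒≤ h<s) k) ⟩
  h ℚ.* s ^ k        <⟨ ℚ.*-monoˡ-<-pos (s ^ k) {{ℚ.positive (0<^ (ℚ.<-trans (0<½^n e) h<s) k)}} h<s ⟩
  s ^ suc k          ∎)
  where
  open ℚ.≤-Reasoning
  h = ½ ^ e

2^-≤½^ : ∀ y {e} → ¬ value y ≤ fromℕ e → 2^- y ≤ fromℚ (½ ^ e)
2^-≤½^ y {e} y≰e r (p , k , s , y≤p/k , 0≤s , s^≤ , r<s) =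
  ℚ.<-≤-trans r<s (root-≤-½^ {s} {p} {e} {k} s^≤ e[1+k]≤p)
  where
  e[1+k]≤p : e ℕ.* suc k ℕ.≤ p
  e[1+k]≤p = ℕ.<⇒≤ (ℕ.≰⇒> λ p≤ →
    y≰e (≤-transℝ {value y} {fromℚ (+ p / suc k)} {fromℕ e} y≤p/k (fromℚ-mono (fraction-mono p e k p≤))))

½^≤2^- : ∀ y {n} → value y ≤ fromℕ n → fromℚ (½ ^ n) ≤ 2^- y
½^≤2^- y {n} y≤n r r<½^n =
  -- The exponent n is the fraction n/1, so k = 0 and no root has to be taken.
  n , 0 , ½ ^ n , y≤n , 0≤½^p n , ℚ.≤-reflexive (ℚ.*-identityʳ (½ ^ n)) , r<½^n

fromℚ-+-≤ : ∀ {p q x y} → fromℚ p ≤ x → fromℚ q ≤ y → fromℚ (p ℚ.+ q) ≤ x + y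
fromℚ-+-≤ {p} {q} p≤x q≤y r r<p+q =
  p ℚ.- δ , q ℚ.- δ , p≤x _ (p-δ<p p) , q≤y _ (p-δ<p q) , <-by (½ ℚ.* gap) (0<p*q 0<½ 0<gap)
    (solve 3 (λ p q r → let gap = p :+ q :- r ; δ = con ½ :* (con ½ :* gap) in
      (p :- δ) :+ (q :- δ) := r :+ con ½ :* gap) refl p q r)
  where
  gap = p ℚ.+ q ℚ.- r
  0<gap = p<q⇒0<q-p r<p+q
  -- A quarter of the gap is given up in each summand, because the points must lie strictly below p
  -- and q; half of it remains.
  δ = ½ ℚ.* (½ ℚ.* gap)
  p-δ<p : ∀ p → p ℚ.- δ ℚ.< p
  p-δ<p p = <-by δ (0<ε/2 (0<ε/2 0<gap)) (solve 2 (λ p d → p := (p :- d) :+ d) refl p δ)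

≤-fromℚ-+ : ∀ {p q x y} → x ≤ fromℚ p → y ≤ fromℚ q → x + y ≤ fromℚ (p ℚ.+ q)
≤-fromℚ-+ x≤p y≤q r (a , b , a∈x , b∈y , r<a+b) =
  ℚ.<-trans r<a+b (ℚ.+-mono-< (x≤p a a∈x) (y≤q b b∈y))

fromℚ-∑≤ : ∀ {f a} → (∀ k → fromℚ (f k) ≤ a k) → ∀ n → fromℚ (∑ℚ f n) ≤ ∑ a n
fromℚ-∑≤ f≤a zero    = λ _ → λ q<0 → q<0
fromℚ-∑≤ {f} {a} f≤a (suc n) = fromℚ-+-≤ {x = ∑ a n} {y = a n} (fromℚ-∑≤ f≤a n) (f≤a n)

∑≤fromℚ : ∀ {f a} → (∀ k → a k ≤ fromℚ (f k)) → ∀ n → ∑ a n ≤ fromℚ (∑ℚ f n)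
∑≤fromℚ a≤f zero    = λ _ → λ q<0 → q<0
∑≤fromℚ {f} {a} a≤f (suc n) = ≤-fromℚ-+ {x = ∑ a n} {y = a n} (∑≤fromℚ a≤f n) (a≤f n)

∑=∞⇒Unbounded : ∀ {a f} → (∀ k → a k ≤ fromℚ (f k)) → ∑=∞ a → Unbounded f
∑=∞⇒Unbounded {a} {f} a≤f diverges b =
  let n , q , q∈∑a , q≮b = diverges (fromℚ b)
  in n , ℚ.≤-trans (ℚ.≮⇒≥ q≮b) (ℚ.<⇒≤ (∑≤fromℚ {f} {a} a≤f n q q∈∑a))

∑<∞⇒bounded : ∀ {a f} → (∀ k → fromℚ (f k) ≤ a k) → ∑<∞ a → ∃[ b ] ∀ n → ∑ℚ f n ℚ.≤ b
∑<∞⇒bounded {a} {f} f≤a (B , ∑a≤B) =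
  let b , b∉B = bounded B
  in b , λ n → ℚ.≮⇒≥ λ b<∑f → b∉B (∑a≤B n b (fromℚ-∑≤ {f} {a} f≤a n b b<∑f))

-- Otherwise a block of sum at least ε starts at every index, and concatenating enough such blocks
-- exceeds b.
bounded⇒small-tails : EM → ∀ {f b} → (∀ n → ∑ℚ f n ℚ.≤ b) →
  ∀ ε → 0ℚ ℚ.< ε → ∃[ N ] ∀ m → ∑ℚ (f ∘ (N ℕ.+_)) m ℚ.≤ ε
bounded⇒small-tails em {f} {b} ∑f≤b ε 0<ε with decide em (∃[ N ] ∀ m → ∑ℚ (f ∘ (N ℕ.+_)) m ℚ.≤ ε)
... | yes small = small
... | no ¬small = ⊥-elim (ℚ.<-irrefl refl (ℚ.<-≤-trans (<-by 1ℚ (ℚ.positive⁻¹ 1ℚ) refl)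
        (ℚ.≤-trans (proj₂ large) (ℚ.≤-trans (proj₂ (grow (proj₁ large))) (∑f≤b (proj₁ (grow (proj₁ large))))))))
  where
  large : ∃[ n ] b ℚ.+ 1ℚ ℚ.≤ ∑ℚ (λ _ → ε) n
  large = archimedean 0<ε (b ℚ.+ 1ℚ)
  big-tail : ∀ N → ∃[ m ] ε ℚ.≤ ∑ℚ (f ∘ (N ℕ.+_)) m
  big-tail N with decide em (∃[ m ] ε ℚ.≤ ∑ℚ (f ∘ (N ℕ.+_)) m)
  ... | yes big = big
  ... | no ¬big = ⊥-elim (¬small (N , λ m → ℚ.<⇒≤ (ℚ.≰⇒> λ ε≤ → ¬big (m , ε≤))))
  grow : ∀ j → ∃[ M ] ∑ℚ (λ _ → ε) j ℚ.≤ ∑ℚ f M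
  grow zero    = 0 , ℚ.≤-refl
  grow (suc j) =
    let M , ≤∑M = grow j
        m , ε≤ = big-tail M
    in M ℕ.+ m , subst (∑ℚ (λ _ → ε) (suc j) ℚ.≤_) (sym (∑-shift f M m)) (ℚ.+-mono-≤ ≤∑M ε≤)

threshold : EM → ∀ y → ∃[ e ] (value y ≤ fromℕ (suc e) × ¬ value y ≤ fromℕ e)
threshold em y = switch (λ n → decide em (value y ≤ fromℕ n)) y≰0 n y≤n
  where
  u = proj₁ (bounded (value y))
  n = proj₁ (above-natural u)
  y≤n : value y ≤ fromℕ n
  y≤n q q∈y = ℚ.<-≤-trans (below-<-above (value y) q∈y (proj₂ (bounded (value y)))) (proj₂ (above-natural u))
  -- Positivity of y starts the search and makes the threshold a natural number.
  y≰0 : ¬ value y ≤ fromℕ 0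
  y≰0 y≤0 = let q , q∈y , q≮0 = positive y in q≮0 (y≤0 q q∈y)

-- Expansions of real numbers

-- Half of the margin absorbs the distance from the partial sum to x; the other half keeps the
-- inequalities strict.
Inside⇒∈ : ∀ {x d} I → IsExpansion x d → Inside d I → x ∈ I
Inside⇒∈ {x} {d} I (_ , converges) (η , 0<η , N , inside) =
  (left I , s-½η≤x (left I) l<s-½η , ℚ.<-irrefl refl) ,
  (s ℚ.+ ½ ℚ.* η , s+½η<r , λ u∈x → ℚ.<-irrefl refl (x≤s+½η (s ℚ.+ ½ ℚ.* η) u∈x))
  where
  close = converges (½ ℚ.* η) (0<ε/2 0<η)
  M = proj₁ close
  n = N ℕ.⊔ M
  s = partialSum d n
  s-½η≤x = proj₁ (proj₂ close n (ℕ.m≤n⊔m N M))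
  x≤s+½η = proj₂ (proj₂ close n (ℕ.m≤n⊔m N M))
  bounds = inside n (ℕ.m≤m⊔n N M)
  l<s-½η : left I ℚ.< s ℚ.- ½ ℚ.* η
  l<s-½η = ℚ.<-≤-trans (<-by (½ ℚ.* η) (0<ε/2 0<η) refl)
    (subst (ℚ._≤ s ℚ.- ½ ℚ.* η)
      (solve 2 (λ l e → (l :+ e) :- con ½ :* e := l :+ con ½ :* e) refl (left I) η)
      (ℚ.+-monoˡ-≤ (ℚ.- (½ ℚ.* η)) (proj₁ bounds)))
  s+½η<r : s ℚ.+ ½ ℚ.* η ℚ.< right I
  s+½η<r = ℚ.≤-<-trans (ℚ.+-monoˡ-≤ (½ ℚ.* η) (proj₂ bounds))
    (<-by (½ ℚ.* η) (0<ε/2 0<η)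
      (solve 2 (λ r e → r := ((r :- e) :+ con ½ :* e) :+ con ½ :* e) refl (right I) η))

HasExpansionIn : ((ℕ → ℕ) → Set) → Subset
HasExpansionIn P x = ∃[ d ] (IsExpansion x d × P d)

SeqCovering⇒CoverTotal : ∀ {P t} → SeqCovering P t → CoverTotal (HasExpansionIn P) t
SeqCovering⇒CoverTotal (I , covers , total≤) =
  I , (λ x (d , exp , p) →
        let k , inside = covers d (proj₁ exp , p) in k , Inside⇒∈ {x} {d} (I k) exp inside)
    , total≤

≮⇒≥ : ∀ {x u} → ¬ fromℚ u < x → x ≤ fromℚ u
≮⇒≥ u≮x r r∈x = ℚ.≰⇒> λ u≤r → u≮x (r , r∈x , λ r<u → ℚ.<-irrefl refl (ℚ.<-≤-trans r<u u≤r))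

module Greedy (em : EM) (x : ℝ) (0<x : fromℚ 0ℚ < x) (x≤1 : x ≤ fromℚ 1ℚ) where

  -- After n digits, 2^exponent (x - sum) is T^n x; the two inequalities say that it lies in (0,1].
  record Stage : Set where
    constructor stage
    field
      exponent : ℕ
      sum      : ℚ
      sum<x    : fromℚ sum < x
      x≤       : x ≤ fromℚ (sum ℚ.+ ½ ^ exponent)

  open Stage

  -- Rescaled, this places T^n x in (2^(-m-1), 2^(-m)], so the digit is m + 1. The search starts at
  -- m = 0, where the upper bound of the stage applies.
  next-digit : ∀ S → ∃[ m ] (fromℚ (sum S ℚ.+ ½ ^ (exponent S ℕ.+ suc m)) < x
                          × ¬ fromℚ (sum S ℚ.+ ½ ^ (exponent S ℕ.+ m)) < x)
  next-digit (stage D s (q , q∈x , q≮s) x≤) =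
    let r , q<r , r∈x = rounded x q∈x
        s<r = ℚ.≤-<-trans (ℚ.≮⇒≥ q≮s) q<r
        n , h≤r-s = ½^-small (p<q⇒0<q-p s<r)
    in switch (λ n → decide em (fromℚ (s ℚ.+ ½ ^ (D ℕ.+ n)) < x)) too-large n (fits n r∈x h≤r-s)
    where
    fits : ∀ {r} n → Below x r → ½ ^ n ℚ.≤ r ℚ.- s → fromℚ (s ℚ.+ ½ ^ (D ℕ.+ n)) < x
    fits {r} n r∈x h≤r-s = r , r∈x , λ r<s+h → ℚ.<-irrefl refl (begin-strict
      r                           <⟨ r<s+h ⟩
      s ℚ.+ ½ ^ (D ℕ.+ n)         ≤⟨ ℚ.+-monoʳ-≤ s (½^-antimono (ℕ.m≤n+m n D)) ⟩
      s ℚ.+ ½ ^ n                 ≤⟨ ℚ.+-monoʳ-≤ s h≤r-s ⟩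
      s ℚ.+ (r ℚ.- s)             ≡⟨ solve 2 (λ s r → s :+ (r :- s) := r) refl s r ⟩
      r                           ∎)
      where open ℚ.≤-Reasoning
    too-large : ¬ fromℚ (s ℚ.+ ½ ^ (D ℕ.+ 0)) < x
    too-large (t , t∈x , t≮) = t≮ (x≤′ t t∈x)
      where
      x≤′ : x ≤ fromℚ (s ℚ.+ ½ ^ (D ℕ.+ 0))
      x≤′ rewrite ℕ.+-identityʳ D = x≤

  next : Stage → Stage
  next S@(stage D s _ _) =
    let m , fits , ¬fits = next-digit S
    in stage (D ℕ.+ suc m) (s ℚ.+ ½ ^ (D ℕ.+ suc m)) fits
         (subst (λ u → x ≤ fromℚ u) (remainder m) (≮⇒≥ {x} ¬fits))
    where
    remainder : ∀ m → s ℚ.+ ½ ^ (D ℕ.+ m) ≡ s ℚ.+ ½ ^ (D ℕ.+ suc m) ℚ.+ ½ ^ (D ℕ.+ suc m)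
    remainder m rewrite ℕ.+-suc D m =
      solve 2 (λ s h → s :+ h := s :+ con ½ :* h :+ con ½ :* h) refl s (½ ^ (D ℕ.+ m))

  stages : ℕ → Stage
  stages zero    = stage 0 0ℚ 0<x x≤1
  stages (suc n) = next (stages n)

  digits : ℕ → ℕ
  digits n = suc (proj₁ (next-digit (stages n)))

  digitSum-digits : ∀ n → digitSum digits n ≡ exponent (stages (suc n))
  digitSum-digits zero    = refl
  digitSum-digits (suc n) = cong (ℕ._+ digits (suc n)) (digitSum-digits n)

  partialSum-digits : ∀ n → partialSum digits n ≡ sum (stages n)
  partialSum-digits zero    = refl
  partialSum-digits (suc n) = cong₂ ℚ._+_ (partialSum-digits n) (cong (½ ^_) (digitSum-digits n))

  n≤exponent : ∀ n → n ℕ.≤ exponent (stages n)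
  n≤exponent zero    = ℕ.z≤n
  n≤exponent (suc n) = ℕ.≤-trans (ℕ.s≤s (n≤exponent n))
    (subst (suc (exponent (stages n)) ℕ.≤_) (sym (ℕ.+-suc (exponent (stages n)) _)) (ℕ.s≤s (ℕ.m≤m+n _ _)))

  isExpansion : IsExpansion x digits
  isExpansion = (λ _ → ℕ.s≤s ℕ.z≤n) , λ ε 0<ε → let N , h≤ε = ½^-small 0<ε in N , converges 0<ε N h≤ε
    where
    close : ∀ S {ε} → 0ℚ ℚ.< ε → ½ ^ exponent S ℚ.≤ ε → (fromℚ (sum S ℚ.- ε) ≤ x × x ≤ fromℚ (sum S ℚ.+ ε))
    close (stage D s (q , q∈x , q≮s) x≤) {ε} 0<ε h≤ε =
        (λ r r<s-ε → closed x (ℚ.<-≤-trans (ℚ.<-trans r<s-ε s-ε<s) (ℚ.≮⇒≥ q≮s)) q∈x)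
      , (λ r r∈x → ℚ.<-≤-trans (x≤ r r∈x) (ℚ.+-monoʳ-≤ s h≤ε))
      where
      s-ε<s : s ℚ.- ε ℚ.< s
      s-ε<s = <-by ε 0<ε (solve 2 (λ s e → s := (s :- e) :+ e) refl s ε)

    converges : ∀ {ε} → 0ℚ ℚ.< ε → ∀ N → ½ ^ N ℚ.≤ ε → ∀ n → N ℕ.≤ n →
      (fromℚ (partialSum digits n ℚ.- ε) ≤ x × x ≤ fromℚ (partialSum digits n ℚ.+ ε))
    converges {ε} 0<ε N h≤ε n N≤n = subst
      (λ s → fromℚ (s ℚ.- ε) ≤ x × x ≤ fromℚ (s ℚ.+ ε)) (sym (partialSum-digits n))
      (close (stages n) 0<ε (ℚ.≤-trans (½^-antimono (ℕ.≤-trans N≤n (n≤exponent n))) h≤ε))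

-- Every cover of (0,1] has total length at least 1

∑-mono-bump : ∀ {f g c k} → (∀ j → f j ℚ.≤ g j) → f k ℚ.+ c ℚ.≤ g k →
  ∀ {n} → k ℕ.< n → ∑ℚ f n ℚ.+ c ℚ.≤ ∑ℚ g n
∑-mono-bump {f} {g} {c} {k} f≤g fk+c≤gk {suc n} (ℕ.s≤s k≤n) with ℕ.m≤n⇒m<n∨m≡n k≤n
... | inj₁ k<n = subst (ℚ._≤ ∑ℚ g (suc n))
        (solve 3 (λ s c x → (s :+ c) :+ x := s :+ x :+ c) refl (∑ℚ f n) c (f n))
        (ℚ.+-mono-≤ (∑-mono-bump f≤g fk+c≤gk k<n) (f≤g n))
... | inj₂ refl = subst (ℚ._≤ ∑ℚ g (suc n)) (sym (ℚ.+-assoc (∑ℚ f n) (f n) c))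
        (ℚ.+-mono-≤ (∑-mono f≤g n) fk+c≤gk)

-- The length of the part of I below q, clamped at 0 when I lies above q.
lengthBelow : ℚ → OpenInterval → ℚ
lengthBelow q I = 0ℚ ℚ.⊔ (right I ℚ.⊓ q ℚ.- left I)

lengthBelow-mono : ∀ {q r} → q ℚ.≤ r → ∀ I → lengthBelow q I ℚ.≤ lengthBelow r I
lengthBelow-mono q≤r I =
  ℚ.⊔-monoʳ-≤ 0ℚ (ℚ.+-monoˡ-≤ (ℚ.- left I) (ℚ.⊓-monoʳ-≤ (right I) q≤r))

lengthBelow≤length : ∀ q I → lengthBelow q I ℚ.≤ length I
lengthBelow≤length q I = ℚ.⊔-lub (0≤length I) (ℚ.+-monoˡ-≤ (ℚ.- left I) (ℚ.p⊓q≤p (right I) q))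

lengthBelow-inside : ∀ {q} I → left I ℚ.≤ q → q ℚ.≤ right I → lengthBelow q I ≡ q ℚ.- left I
lengthBelow-inside I l≤q q≤r rewrite ℚ.p≥q⇒p⊓q≡q q≤r = ℚ.p≤q⇒p⊔q≡q (p≤q⇒0≤q-p l≤q)

HalfOpenUnit : Subset
HalfOpenUnit x = fromℚ 0ℚ < x × x ≤ fromℚ 1ℚ

-- A supremum argument takes the place of compactness. The supremum of the reachable points lies in
-- some `I k`, and extending along `I k` would pass it unless 1 is reached. The start at δ > 0 keeps
-- the supremum off 0, which the cover may miss.
module CoverOfUnit (I : ℕ → OpenInterval) (covers : HalfOpenUnit CoveredBy I)
  (δ : ℚ) (0<δ : 0ℚ ℚ.< δ) (δ≤1 : δ ℚ.≤ 1ℚ) where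

  -- Up to δ, finitely many of the intervals account for the length of (0, q].
  Reachable : ℚ → Set
  Reachable q = ∃[ n ] q ℚ.≤ δ ℚ.+ ∑ℚ (λ k → lengthBelow q (I k)) n

  reach-δ : Reachable δ
  reach-δ = 0 , ℚ.≤-reflexive (sym (ℚ.+-identityʳ δ))

  extend : ∀ {q r} k → Reachable q → left (I k) ℚ.≤ q → q ℚ.≤ r → r ℚ.≤ right (I k) → Reachable r
  extend {q} {r} k (n , q≤) l≤q q≤r r≤right = N , (begin
    r                                                  ≡⟨ solve 2 (λ q r → r := q :+ (r :- q)) refl q r ⟩
    q ℚ.+ (r ℚ.- q)                                    ≤⟨ ℚ.+-monoˡ-≤ (r ℚ.- q) q≤ ⟩
    δ ℚ.+ ∑ℚ (λ j → lengthBelow q (I j)) n ℚ.+ (r ℚ.- q)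
      ≤⟨ ℚ.+-monoˡ-≤ (r ℚ.- q) (ℚ.+-monoʳ-≤ δ (∑-monoʳ (λ j → ℚ.p≤p⊔q 0ℚ (right (I j) ℚ.⊓ q ℚ.- left (I j))) (ℕ.m≤m⊔n n (suc k)))) ⟩
    δ ℚ.+ ∑ℚ (λ j → lengthBelow q (I j)) N ℚ.+ (r ℚ.- q)
      ≡⟨ ℚ.+-assoc δ (∑ℚ (λ j → lengthBelow q (I j)) N) (r ℚ.- q) ⟩
    δ ℚ.+ (∑ℚ (λ j → lengthBelow q (I j)) N ℚ.+ (r ℚ.- q))
      ≤⟨ ℚ.+-monoʳ-≤ δ (∑-mono-bump (λ j → lengthBelow-mono q≤r (I j)) growth (ℕ.m≤n⊔m n (suc k))) ⟩
    δ ℚ.+ ∑ℚ (λ j → lengthBelow r (I j)) N ∎)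
    where
    open ℚ.≤-Reasoning
    N = n ℕ.⊔ suc k
    growth : lengthBelow q (I k) ℚ.+ (r ℚ.- q) ℚ.≤ lengthBelow r (I k)
    growth = ℚ.≤-reflexive (begin-equality
      lengthBelow q (I k) ℚ.+ (r ℚ.- q)
        ≡⟨ cong (ℚ._+ (r ℚ.- q)) (lengthBelow-inside (I k) l≤q (ℚ.≤-trans q≤r r≤right)) ⟩
      (q ℚ.- left (I k)) ℚ.+ (r ℚ.- q)
        ≡⟨ solve 3 (λ q r l → (q :- l) :+ (r :- q) := r :- l) refl q r (left (I k)) ⟩
      r ℚ.- left (I k)                     ≡⟨ sym (lengthBelow-inside (I k) (ℚ.≤-trans l≤q q≤r) r≤right) ⟩
      lengthBelow r (I k)                  ∎)

  sup : ℝ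
  sup .Below q = ∃[ r ] (q ℚ.< r × r ℚ.≤ 1ℚ × Reachable r)
  sup .inhabited = δ ℚ.- 1ℚ , δ , q-1<q δ , δ≤1 , reach-δ
  sup .bounded = 1ℚ , λ (r , 1<r , r≤1 , _) → ℚ.<-irrefl refl (ℚ.<-≤-trans 1<r r≤1)
  sup .closed q<q′ (r , q′<r , rest) = r , ℚ.<-trans q<q′ q′<r , rest
  sup .rounded (r , q<r , rest) =
    let q′ , q<q′ , q′<r = ℚ.<-dense q<r in q′ , q<q′ , r , q′<r , rest

  sup∈unit : HalfOpenUnit sup
  sup∈unit = (0ℚ , (δ , 0<δ , δ≤1 , reach-δ) , ℚ.<-irrefl refl)
           , λ q (r , q<r , r≤1 , _) → ℚ.<-≤-trans q<r r≤1

  reach-1 : Reachable 1ℚ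
  reach-1 = past-sup k l<s s<r
    where
    k = proj₁ (covers sup sup∈unit)
    l<s = proj₁ (proj₂ (covers sup sup∈unit))
    s<r = proj₂ (proj₂ (covers sup sup∈unit))
    past-sup : ∀ k → fromℚ (left (I k)) < sup → sup < fromℚ (right (I k)) → Reachable 1ℚ
    past-sup k (q , (r , q<r , r≤1 , reach) , q≮l) (u , u<right , u∉sup) = from-m (ℚ.<-dense u<right)
      where
      l≤r : left (I k) ℚ.≤ r
      l≤r = ℚ.≤-trans (ℚ.≮⇒≥ q≮l) (ℚ.<⇒≤ q<r)
      r≤u : r ℚ.≤ u
      r≤u = ℚ.≮⇒≥ (λ u<r → u∉sup (r , u<r , r≤1 , reach))
      -- The point m lies strictly beyond u, hence beyond the supremum: if m ≤ 1, reaching it is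
      -- contradictory, and otherwise `I k` extends past 1.
      from-m : ∃[ m ] (u ℚ.< m × m ℚ.< right (I k)) → Reachable 1ℚ
      from-m (m , u<m , m<right) with m ℚ.≤? 1ℚ
      ... | yes m≤1 = ⊥-elim (u∉sup (m , u<m , m≤1 ,
              extend k reach l≤r (ℚ.≤-trans r≤u (ℚ.<⇒≤ u<m)) (ℚ.<⇒≤ m<right)))
      ... | no  m≰1 = extend k reach l≤r r≤1 (ℚ.<⇒≤ (ℚ.<-trans (ℚ.≰⇒> m≰1) m<right))

cover-of-unit-≥1 : ∀ {t} → CoverTotal HalfOpenUnit t → 1ℚ ℚ.≤ t
cover-of-unit-≥1 {t} (I , covers , total≤) = p≤q+ε⇒p≤q 1≤t+ε
  where
  open ℚ.≤-Reasoning
  1≤t+ε : ∀ ε → 0ℚ ℚ.< ε → 1ℚ ℚ.≤ t ℚ.+ ε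
  1≤t+ε ε 0<ε with ε ℚ.≤? 1ℚ
  ... | no ε≰1 = ℚ.≤-trans (ℚ.<⇒≤ (ℚ.≰⇒> ε≰1)) (subst (ℚ._≤ t ℚ.+ ε) (ℚ.+-identityˡ ε) (ℚ.+-monoˡ-≤ ε (total≤ 0)))
  ... | yes ε≤1 = finish (CoverOfUnit.reach-1 I covers ε 0<ε ε≤1)
    where
    finish : CoverOfUnit.Reachable I covers ε 0<ε ε≤1 1ℚ → 1ℚ ℚ.≤ t ℚ.+ ε
    finish (n , 1≤) = begin
      1ℚ                                               ≤⟨ 1≤ ⟩
      ε ℚ.+ ∑ℚ (λ k → lengthBelow 1ℚ (I k)) n
        ≤⟨ ℚ.+-monoʳ-≤ ε (∑-mono (λ k → lengthBelow≤length 1ℚ (I k)) n) ⟩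
      ε ℚ.+ total I n                                  ≤⟨ ℚ.+-monoʳ-≤ ε (total≤ n) ⟩
      ε ℚ.+ t                                          ≡⟨ ℚ.+-comm ε t ⟩
      t ℚ.+ ε                                          ∎

-- Outer measure and Carathéodory measurability

module Real = Coverings _∈_

Null : Subset → Set₁
Null A = ∀ ε → 0ℚ ℚ.< ε → CoverTotal A ε

≤fromℚ-+ε⇒≤fromℚ : ∀ {x q} → (∀ ε → 0ℚ ℚ.< ε → x ≤ fromℚ (q ℚ.+ ε)) → x ≤ fromℚ q
≤fromℚ-+ε⇒≤fromℚ {x} x≤q+ε p p∈x =
  let r , p<r , r∈x = rounded x p∈x
  in ℚ.<-≤-trans p<r (p≤q+ε⇒p≤q λ ε 0<ε → ℚ.<⇒≤ (x≤q+ε ε 0<ε r r∈x))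

-- Carathéodory's criterion on covers: any cover of E can be traded for covers of its two parts at
-- an extra cost ε. In this form it passes to complements and intersections without values of outer
-- measures.
Splits : Subset → Set₁
Splits A = ∀ E t ε → 0ℚ ℚ.< ε → CoverTotal E t →
  ∃[ s ] ∃[ u ] (CoverTotal (E ∩ A) s × CoverTotal (E ∖ A) u × s ℚ.+ u ℚ.≤ t ℚ.+ ε)

module Measure (em : EM) where

  ¬¬-elim : ∀ {P : Set} → ¬ ¬ P → P
  ¬¬-elim {P} ¬¬p with decide em P
  ... | yes p = p
  ... | no ¬p = ⊥-elim (¬¬p ¬p)

  approximate : ∀ x {δ} → 0ℚ ℚ.< δ → ∃[ a ] (Below x a × ¬ Below x (a ℚ.+ δ))
  approximate x {δ} 0<δ =
    let a , a∈x = inhabited x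
        u , u∉x = bounded x
        n , u-a≤nδ = archimedean 0<δ (u ℚ.- a)
    in search a a∈x (switch (λ n → decide em (¬ Below x (a ℚ.+ ∑ℚ (λ _ → δ) n)))
         (λ a∉x → a∉x (subst (Below x) (sym (ℚ.+-identityʳ a)) a∈x)) n (beyond a u u∉x n u-a≤nδ))
    where
    beyond : ∀ a u → ¬ Below x u → ∀ n → u ℚ.- a ℚ.≤ ∑ℚ (λ _ → δ) n → ¬ Below x (a ℚ.+ ∑ℚ (λ _ → δ) n)
    beyond a u u∉x n u-a≤nδ a+nδ∈x = ℚ.<-irrefl refl (ℚ.<-≤-trans (below-<-above x a+nδ∈x u∉x)
      (subst (ℚ._≤ a ℚ.+ ∑ℚ (λ _ → δ) n) (solve 2 (λ a u → a :+ (u :- a) := u)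
          refl a u) (ℚ.+-monoʳ-≤ a u-a≤nδ)))
    search : ∀ a → Below x a →
      ∃[ m ] (¬ Below x (a ℚ.+ ∑ℚ (λ _ → δ) (suc m)) × ¬ ¬ Below x (a ℚ.+ ∑ℚ (λ _ → δ) m)) →
      ∃[ a ] (Below x a × ¬ Below x (a ℚ.+ δ))
    search a a∈x (m , above , ¬¬below) =
      a ℚ.+ ∑ℚ (λ _ → δ) m , ¬¬-elim ¬¬below , λ p → above (subst (Below x) (ℚ.+-assoc a _ δ) p)

  -- If every cover had total at least d, then d would be a lower bound, so d ≤ m and c would lie
  -- below m. The existence of a cover is a proposition in `Set₁`, whence the level of `EM`.
  efficient-cover : ∀ {A m c d} → IsOuterMeasure A m → ¬ Below m c → c ℚ.< d →
    ∃[ t ] (CoverTotal A t × t ℚ.< d)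
  efficient-cover {A} {m} {c} {d} (_ , greatest) c∉m c<d with em {∃[ t ] (CoverTotal A t × t ℚ.< d)}
  ... | yes cover = cover
  ... | no ¬cover = ⊥-elim (c∉m (greatest (fromℚ d)
          (λ t cov → fromℚ-mono (ℚ.≮⇒≥ λ t<d → ¬cover (t , cov , t<d))) c c<d))

  CoverTotal-split : ∀ {E A s u} → CoverTotal (E ∩ A) s → CoverTotal (E ∖ A) u → CoverTotal E (s ℚ.+ u)
  CoverTotal-split {E} {A} inside outside = Real.Covering-⊆ {E} cases (Real.Covering-∪ inside outside)
    where
    cases : ∀ {x} → E x → (E ∩ A) x ⊎ (E ∖ A) x
    cases {x} x∈E with decide em (A x)
    ... | yes x∈A = inj₁ (x∈E , x∈A)
    ... | no  x∉A = inj₂ (x∈E , x∉A)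

  Splits⇒Measurable : ∀ {A} → Splits A → Measurable A
  Splits⇒Measurable {A} splits E e a b measE measIn measOut = e≤a+b , a+b≤e
    where
    e≤a+b : e ≤ a + b
    e≤a+b q q∈e =
      let r , q<r , r∈e = rounded e q∈e
          -- A quarter of r - q: each of a and b loses one δ to its rational approximation and one
          -- to its cover.
          0<δ = 0<ε/2 (0<ε/2 (p<q⇒0<q-p q<r))
          a₀ , a₀∈a , a₀+δ∉a = approximate a 0<δ
          b₀ , b₀∈b , b₀+δ∉b = approximate b 0<δ
      in a₀ , b₀ , a₀∈a , b₀∈b , close r r∈e a₀ b₀ 0<δ
           (efficient-cover {E ∩ A} {a} measIn a₀+δ∉a (<-by _ 0<δ refl))
           (efficient-cover {E ∖ A} {b} measOut b₀+δ∉b (<-by _ 0<δ refl))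
      where
      close : ∀ r → Below e r → ∀ a₀ b₀ → let δ = ½ ℚ.* (½ ℚ.* (r ℚ.- q)) in 0ℚ ℚ.< δ →
        ∃[ s ] (CoverTotal (E ∩ A) s × s ℚ.< a₀ ℚ.+ δ ℚ.+ δ) →
        ∃[ u ] (CoverTotal (E ∖ A) u × u ℚ.< b₀ ℚ.+ δ ℚ.+ δ) →
        q ℚ.< a₀ ℚ.+ b₀
      close r r∈e a₀ b₀ 0<δ (s , covIn , s<) (u , covOut , u<) = begin-strict
        q                                                ≡⟨ solve 2 (λ q r → q := r :+ (q :- r)) refl q r ⟩
        r ℚ.+ (q ℚ.- r)
          <⟨ ℚ.+-monoˡ-< (q ℚ.- r) (proj₁ measE (s ℚ.+ u) (CoverTotal-split {E} {A} covIn covOut) r r∈e) ⟩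
        s ℚ.+ u ℚ.+ (q ℚ.- r)                            <⟨ ℚ.+-monoˡ-< (q ℚ.- r) (ℚ.+-mono-< s< u<) ⟩
        (a₀ ℚ.+ δ ℚ.+ δ) ℚ.+ (b₀ ℚ.+ δ ℚ.+ δ) ℚ.+ (q ℚ.- r)
          ≡⟨ solve 4 (λ a b q r → let d = con ½ :* (con ½ :* (r :- q)) in
               (a :+ d :+ d) :+ (b :+ d :+ d) :+ (q :- r) := a :+ b) refl a₀ b₀ q r ⟩
        a₀ ℚ.+ b₀                                        ∎
        where
        open ℚ.≤-Reasoning
        δ = ½ ℚ.* (½ ℚ.* (r ℚ.- q))
    a+b≤e : a + b ≤ e
    a+b≤e q (a₀ , b₀ , a₀∈a , b₀∈b , q<a₀+b₀) = proj₂ measE (fromℚ (a₀ ℚ.+ b₀)) lower q q<a₀+b₀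
      where
      lower : ∀ t → CoverTotal E t → fromℚ (a₀ ℚ.+ b₀) ≤ fromℚ t
      lower t cov = fromℚ-mono (p≤q+ε⇒p≤q λ ε 0<ε →
        let s , u , covIn , covOut , s+u≤ = splits E t ε 0<ε cov
        in ℚ.≤-trans (ℚ.<⇒≤ (ℚ.+-mono-< (proj₁ measIn s covIn a₀ a₀∈a) (proj₁ measOut u covOut b₀ b₀∈b))) s+u≤)

  Null⇒Splits : ∀ {A} → Null A → Splits A
  Null⇒Splits null E t ε 0<ε cov =
    ε , t , Real.Covering-⊆ proj₂ (null ε 0<ε) , Real.Covering-⊆ proj₁ cov , ℚ.≤-reflexive (ℚ.+-comm ε t)

  Splits-⇔ : ∀ {A B} → (∀ {x} → A x → B x) → (∀ {x} → B x → A x) → Splits A → Splits B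
  Splits-⇔ A⊆B B⊆A splits E t ε 0<ε cov =
    let s , u , covIn , covOut , s+u≤ = splits E t ε 0<ε cov
    in s , u , Real.Covering-⊆ (λ (x∈E , x∈B) → x∈E , B⊆A x∈B) covIn
             , Real.Covering-⊆ (λ (x∈E , x∉B) → x∈E , λ x∈A → x∉B (A⊆B x∈A)) covOut , s+u≤

  Splits-∁ : ∀ {A} → Splits A → Splits (λ x → ¬ A x)
  Splits-∁ splits E t ε 0<ε cov =
    let s , u , covIn , covOut , s+u≤ = splits E t ε 0<ε cov
    in u , s , covOut , Real.Covering-⊆ (λ (x∈E , ¬x∉A) → x∈E , ¬¬-elim ¬x∉A) covIn
         , subst (ℚ._≤ t ℚ.+ ε) (ℚ.+-comm s u) s+u≤

  -- E is split by A and then E ∩ A by B, each at cost ε/2; E ∖ (A ∩ B) is made of (E ∩ A) ∖ B and E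
  -- ∖ A.
  Splits-∩ : ∀ {A B} → Splits A → Splits B → Splits (A ∩ B)
  Splits-∩ {A} {B} splitsA splitsB E t ε 0<ε cov =
    let s , u , covIn , covOut , s+u≤ = splitsA E t (½ ℚ.* ε) (0<ε/2 0<ε) cov
        v , w , covInIn , covInOut , v+w≤ = splitsB (E ∩ A) s (½ ℚ.* ε) (0<ε/2 0<ε) covIn
    in v , w ℚ.+ u
         , Real.Covering-⊆ (λ (x∈E , x∈A , x∈B) → (x∈E , x∈A) , x∈B) covInIn
         , Real.Covering-⊆ {E ∖ (A ∩ B)} cases (Real.Covering-∪ covInOut covOut)
         , bound s u v w s+u≤ v+w≤
    where
    cases : ∀ {x} → (E ∖ (A ∩ B)) x → ((E ∩ A) ∖ B) x ⊎ (E ∖ A) x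
    cases {x} (x∈E , x∉A∩B) with decide em (A x)
    ... | yes x∈A = inj₁ ((x∈E , x∈A) , λ x∈B → x∉A∩B (x∈A , x∈B))
    ... | no  x∉A = inj₂ (x∈E , x∉A)
    bound : ∀ s u v w → s ℚ.+ u ℚ.≤ t ℚ.+ ½ ℚ.* ε → v ℚ.+ w ℚ.≤ s ℚ.+ ½ ℚ.* ε → v ℚ.+ (w ℚ.+ u) ℚ.≤ t ℚ.+ ε
    bound s u v w s+u≤ v+w≤ = begin
      v ℚ.+ (w ℚ.+ u)                  ≡⟨ sym (ℚ.+-assoc v w u) ⟩
      v ℚ.+ w ℚ.+ u                    ≤⟨ ℚ.+-monoˡ-≤ u v+w≤ ⟩
      s ℚ.+ ½ ℚ.* ε ℚ.+ u
        ≡⟨ solve 3 (λ s u e → s :+ e :+ u := (s :+ u) :+ e) refl s u (½ ℚ.* ε) ⟩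
      (s ℚ.+ u) ℚ.+ ½ ℚ.* ε            ≤⟨ ℚ.+-monoˡ-≤ (½ ℚ.* ε) s+u≤ ⟩
      t ℚ.+ ½ ℚ.* ε ℚ.+ ½ ℚ.* ε        ≡⟨ solve 2 (λ t e → t :+ con ½ :* e :+ con ½ :* e := t :+ e) refl t ε ⟩
      t ℚ.+ ε                          ∎
      where open ℚ.≤-Reasoning

  -- Cutting covers at a rational point

  leftPart rightPart : ℚ → OpenInterval → OpenInterval
  leftPart c I = record
    { left = left I ℚ.⊓ c ; right = right I ℚ.⊓ c ; left≤right = ℚ.⊓-monoˡ-≤ c (left≤right I) }
  rightPart c I = record
    { left = left I ℚ.⊔ c ; right = right I ℚ.⊔ c ; left≤right = ℚ.⊔-monoˡ-≤ c (left≤right I) }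

  length-parts : ∀ c I → length (rightPart c I) ℚ.+ length (leftPart c I) ≡ length I
  length-parts c I = begin
    ((r ℚ.⊔ c) ℚ.- (l ℚ.⊔ c)) ℚ.+ ((r ℚ.⊓ c) ℚ.- (l ℚ.⊓ c))
      ≡⟨ solve 4 (λ a b c d → (a :- b) :+ (c :- d) := (c :+ a) :- (d :+ b))
          refl (r ℚ.⊔ c) (l ℚ.⊔ c) (r ℚ.⊓ c) (l ℚ.⊓ c) ⟩
    ((r ℚ.⊓ c) ℚ.+ (r ℚ.⊔ c)) ℚ.- ((l ℚ.⊓ c) ℚ.+ (l ℚ.⊔ c))
      ≡⟨ cong₂ ℚ._-_ (⊓+⊔ r) (⊓+⊔ l) ⟩
    (r ℚ.+ c) ℚ.- (l ℚ.+ c)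
      ≡⟨ solve 3 (λ r l c → (r :+ c) :- (l :+ c) := r :- l) refl r l c ⟩
    r ℚ.- l ∎
    where
    open ≡-Reasoning
    l = left I
    r = right I
    ⊓+⊔ : ∀ p → (p ℚ.⊓ c) ℚ.+ (p ℚ.⊔ c) ≡ p ℚ.+ c
    ⊓+⊔ p with ℚ.≤-total p c
    ... | inj₁ p≤c = cong₂ ℚ._+_ (ℚ.p≤q⇒p⊓q≡p p≤c) (ℚ.p≤q⇒p⊔q≡q p≤c)
    ... | inj₂ c≤p = trans (cong₂ ℚ._+_ (ℚ.p≥q⇒p⊓q≡q c≤p) (ℚ.p≥q⇒p⊔q≡p c≤p)) (ℚ.+-comm c p)

  ∈rightPart : ∀ {x} c I → x ∈ I → fromℚ c < x → x ∈ rightPart c I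
  ∈rightPart {x} c I (l<x , (q , q<r , q∉x)) c<x = l⊔c<x , (q , ℚ.<-≤-trans q<r (ℚ.p≤p⊔q (right I) c) , q∉x)
    where
    l⊔c<x : fromℚ (left I ℚ.⊔ c) < x
    l⊔c<x with ℚ.≤-total (left I) c
    ... | inj₁ l≤c rewrite ℚ.p≤q⇒p⊔q≡q l≤c = c<x
    ... | inj₂ c≤l rewrite ℚ.p≥q⇒p⊔q≡p c≤l = l<x

  ∈leftPart : ∀ {x} c I → x ∈ I → x < fromℚ c → x ∈ leftPart c I
  ∈leftPart {x} c I ((q , q∈x , q≮l) , x<r) x<c =
    (q , q∈x , λ q<l⊓c → q≮l (ℚ.<-≤-trans q<l⊓c (ℚ.p⊓q≤p (left I) c))) , x<r⊓c
    where
    x<r⊓c : x < fromℚ (right I ℚ.⊓ c)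
    x<r⊓c with ℚ.≤-total (right I) c
    ... | inj₁ r≤c rewrite ℚ.p≤q⇒p⊓q≡p r≤c = x<r
    ... | inj₂ c≤r rewrite ℚ.p≥q⇒p⊓q≡q c≤r = x<c

  -- The cut point c belongs to neither open part, so it gets a short interval of its own.
  around : ∀ c {δ} → 0ℚ ℚ.< δ → OpenInterval
  around c {δ} 0<δ = record
    { left       = c ℚ.- δ
    ; right      = c ℚ.+ δ
    ; left≤right = ≤-by (δ ℚ.+ δ) (ℚ.+-mono-≤ (ℚ.<⇒≤ 0<δ) (ℚ.<⇒≤ 0<δ))
                     (solve 2 (λ c d → c :+ d := (c :- d) :+ (d :+ d)) refl c δ)
    }

  ∈around : ∀ {x} c {δ} (0<δ : 0ℚ ℚ.< δ) → ¬ fromℚ c < x → ¬ x < fromℚ c → x ∈ around c 0<δ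
  ∈around {x} c {δ} 0<δ c≮x x≮c =
      (c-δ , ¬¬-elim (λ c-δ∉x → x≮c (c-δ , c-δ<c , c-δ∉x)) , ℚ.<-irrefl refl)
    , (c , <-by δ 0<δ refl , λ c∈x → c≮x (c , c∈x , ℚ.<-irrefl refl))
    where
    c-δ = c ℚ.- δ
    c-δ<c : c-δ ℚ.< c
    c-δ<c = <-by δ 0<δ (solve 2 (λ c d → c := (c :- d) :+ d) refl c δ)

  -- The total lengths of the parts of a cover need not have rational suprema,
  -- hence the comparison with the totals of the first N parts.
  Splits-> : ∀ c → Splits (λ x → fromℚ c < x)
  Splits-> c E t ε 0<ε (I , covers , total≤) =
    let N , small = bounded⇒small-tails em total≤ δ 0<δ
    in split N small
    where
    -- Four times δ is spent: one for the tail on each side and two for the interval around c.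
    δ = ½ ℚ.* (½ ℚ.* ε)
    0<δ = 0<ε/2 (0<ε/2 0<ε)
    L R : ℕ → OpenInterval
    L = leftPart c ∘ I
    R = rightPart c ∘ I
    totals : ∀ n → total R n ℚ.+ total L n ≡ total I n
    totals n = trans (sym (∑-+ (length ∘ R) (length ∘ L) n)) (∑-cong (length-parts c ∘ I) n)
    R≤I : ∀ k → length (R k) ℚ.≤ length (I k)
    R≤I k = ≤-by (length (L k)) (0≤length (L k)) (sym (length-parts c (I k)))
    L≤I : ∀ k → length (L k) ℚ.≤ length (I k)
    L≤I k = ≤-by (length (R k)) (0≤length (R k))
      (trans (sym (length-parts c (I k))) (ℚ.+-comm (length (R k)) (length (L k))))

    split : ∀ N → (∀ m → total (I ∘ (N ℕ.+_)) m ℚ.≤ δ) →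
      ∃[ s ] ∃[ u ] (CoverTotal (E ∩ (λ x → fromℚ c < x)) s ×
        CoverTotal (E ∖ (λ x → fromℚ c < x)) u × s ℚ.+ u ℚ.≤ t ℚ.+ ε)
    split N small =
        total R N ℚ.+ δ , (length (around c 0<η) ℚ.+ (total L N ℚ.+ δ))
      , (R , (λ x (x∈E , c<x) → let k , x∈I = covers x x∈E in k , ∈rightPart {x} c (I k) x∈I c<x) , truncate R R≤I)
      , Real.Covering-⊆ {E ∖ (λ x → fromℚ c < x)} cases
          (Real.Covering-∪ (Real.Covering-single {λ x → ¬ fromℚ c < x × ¬ x < fromℚ c} (around c 0<η)
                              (λ x (c≮x , x≮c) → ∈around {x} c 0<η c≮x x≮c))
                           left-cover)
      , ℚ.≤-trans (ℚ.≤-reflexive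
            (solve 4 (λ r l e c → let d = con ½ :* (con ½ :* e) in
               (r :+ d) :+ (((c :+ d) :- (c :- d)) :+ (l :+ d)) := (r :+ l) :+ e) refl (total R N) (total L N) ε c))
          (ℚ.+-monoˡ-≤ ε (subst (ℚ._≤ t) (sym (totals N)) (total≤ N)))
      where
      0<η = 0<δ
      truncate : ∀ J → (∀ k → length (J k) ℚ.≤ length (I k)) → ∀ n → total J n ℚ.≤ total J N ℚ.+ δ
      truncate J J≤I n = begin
        total J n                                ≤⟨ ∑-monoʳ (0≤length ∘ J) (ℕ.m≤n+m n N) ⟩
        total J (N ℕ.+ n)                        ≡⟨ ∑-shift (length ∘ J) N n ⟩
        total J N ℚ.+ total (J ∘ (N ℕ.+_)) n
          ≤⟨ ℚ.+-monoʳ-≤ (total J N) (ℚ.≤-trans (∑-mono (J≤I ∘ (N ℕ.+_)) n) (small n)) ⟩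
        total J N ℚ.+ δ                          ∎
        where open ℚ.≤-Reasoning
      left-cover : CoverTotal (λ x → E x × x < fromℚ c) (total L N ℚ.+ δ)
      left-cover = L , (λ x (x∈E , x<c) → let k , x∈I = covers x x∈E in k , ∈leftPart {x} c (I k) x∈I x<c) , truncate L L≤I
      cases : ∀ {x} → (E ∖ (λ x → fromℚ c < x)) x → (¬ fromℚ c < x × ¬ x < fromℚ c) ⊎ (E x × x < fromℚ c)
      cases {x} (x∈E , c≮x) with decide em (x < fromℚ c)
      ... | yes x<c = inj₂ (x∈E , x<c)
      ... | no  x≮c = inj₁ (c≮x , x≮c)

  Splits-HalfOpenUnit : Splits HalfOpenUnit
  Splits-HalfOpenUnit = Splits-⇔
    (λ {x} (0<x , 1≮x) → 0<x , ≮⇒≥ {x} 1≮x)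
    (λ {x} (0<x , x≤1) → 0<x , λ (q , q∈x , q≮1) → q≮1 (x≤1 q q∈x))
    (Splits-∩ (Splits-> 0ℚ) (Splits-∁ (Splits-> 1ℚ)))

  Null⇒measure-0 : ∀ {A} → Null A → 𝓛 A ≐ fromℚ 0ℚ
  Null⇒measure-0 null = Splits⇒Measurable (Null⇒Splits null)
    , (λ t cov → fromℚ-mono (Real.Covering-≥0 cov))
    , λ b b≤ → ≤fromℚ-+ε⇒≤fromℚ {b} λ ε 0<ε →
        subst (λ u → b ≤ fromℚ u) (sym (ℚ.+-identityˡ ε)) (b≤ ε (null ε 0<ε))

  HalfOpenUnit-cover : ∀ ε → 0ℚ ℚ.< ε → CoverTotal HalfOpenUnit (1ℚ ℚ.+ ε)
  HalfOpenUnit-cover ε 0<ε = Real.Covering-≤ (ℚ.≤-reflexive (ℚ.+-identityʳ (1ℚ ℚ.+ ε)))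
    (Real.Covering-single I (λ x (0<x , x≤1) → 0<x , (1ℚ , <-by ε 0<ε refl , λ 1∈x → ℚ.<-irrefl refl (x≤1 1ℚ 1∈x))))
    where
    I : OpenInterval
    I = record { left = 0ℚ ; right = 1ℚ ℚ.+ ε ; left≤right = ℚ.+-mono-≤ 0≤1 (ℚ.<⇒≤ 0<ε) }

  -- A is (0,1] minus a null set, hence splits. A cover of A joined with a small cover of that null
  -- set covers (0,1], so its total is at least 1.
  conull⇒measure-1 : ∀ {A} → (∀ {x} → A x → HalfOpenUnit x) → Null (HalfOpenUnit ∖ A) → 𝓛 A ≐ fromℚ 1ℚ
  conull⇒measure-1 {A} A⊆unit null =
      Splits⇒Measurable (Splits-⇔ {HalfOpenUnit ∩ (λ x → ¬ (HalfOpenUnit ∖ A) x)} {A}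
        (λ (x∈unit , x∉) → ¬¬-elim (λ x∉A → x∉ (x∈unit , x∉A)))
        (λ x∈A → A⊆unit x∈A , λ (_ , x∉A) → x∉A x∈A)
        (Splits-∩ Splits-HalfOpenUnit (Splits-∁ (Null⇒Splits null))))
    , (λ t cov → fromℚ-mono (p≤q+ε⇒p≤q λ ε 0<ε → cover-of-unit-≥1
        (CoverTotal-split {HalfOpenUnit} {A} (Real.Covering-⊆ proj₂ cov) (null ε 0<ε))))
    , λ b b≤ → ≤fromℚ-+ε⇒≤fromℚ {b} λ ε 0<ε →
        b≤ (1ℚ ℚ.+ ε) (Real.Covering-⊆ A⊆unit (HalfOpenUnit-cover ε 0<ε))

-- From digit thresholds to `F φ`

module Dichotomy (em : EM) (φ : ℕ → ℝ⁺) where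

  open Measure em

  e : ℕ → ℕ
  e n = proj₁ (threshold em (φ n))

  φ≤1+e : ∀ n → value (φ n) ≤ fromℕ (suc (e n))
  φ≤1+e n = proj₁ (proj₂ (threshold em (φ n)))

  φ≰e : ∀ n → ¬ value (φ n) ≤ fromℕ (e n)
  φ≰e n = proj₂ (proj₂ (threshold em (φ n)))

  φ≤⇒e< : ∀ n {m} → value (φ n) ≤ fromℕ m → e n ℕ.< m
  φ≤⇒e< n {m} φ≤m = ℕ.≰⇒> λ m≤e →
    φ≰e n (≤-transℝ {value (φ n)} {fromℕ m} {fromℕ (e n)} φ≤m (fromℕ-mono m≤e))

  e<⇒φ≤ : ∀ n {m} → e n ℕ.< m → value (φ n) ≤ fromℕ m
  e<⇒φ≤ n {m} e<m = ≤-transℝ {value (φ n)} {fromℕ (suc (e n))} {fromℕ m} (φ≤1+e n) (fromℕ-mono e<m)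

  convergent⇒Null : ∑<∞ (λ n → 2^- φ n) → Null (F φ)
  convergent⇒Null converges = from-bound
    (∑<∞⇒bounded {λ n → 2^- φ n} (λ n → ½^≤2^- (φ n) {suc (e n)} (φ≤1+e n)) converges)
    where
    from-bound : ∃[ b ] (∀ n → ∑ℚ (λ k → ½ ^ suc (e k)) n ℚ.≤ b) → Null (F φ)
    from-bound (b , ∑≤b) ε 0<ε = Real.Covering-⊆ {F φ}
      (λ (_ , _ , d , exp , often) →
        d , exp , λ N → let n , N≤n , φ≤d = often N in n , N≤n , φ≤⇒e< n φ≤d)
      (SeqCovering⇒CoverTotal (SeqNull-infinitely-large e (bounded⇒small-tails em {λ k → ½ ^ e k} ∑≤2b) ε 0<ε))
      where
      -- The series bounds the sums of 2^(-e_k-1); doubling passes to 2^(-e_k).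
      ∑≤2b : ∀ n → ∑ℚ (λ k → ½ ^ e k) n ℚ.≤ b ℚ.+ b
      ∑≤2b n = begin
        ∑ℚ (λ k → ½ ^ e k) n
          ≡⟨ ∑-cong (λ k → sym (½*p+½*p≡p (½ ^ e k))) n ⟩
        ∑ℚ (λ k → ½ ^ suc (e k) ℚ.+ ½ ^ suc (e k)) n
          ≡⟨ ∑-+ (λ k → ½ ^ suc (e k)) (λ k → ½ ^ suc (e k)) n ⟩
        ∑ℚ (λ k → ½ ^ suc (e k)) n ℚ.+ ∑ℚ (λ k → ½ ^ suc (e k)) n
          ≤⟨ ℚ.+-mono-≤ (∑≤b n) (∑≤b n) ⟩
        b ℚ.+ b ∎
        where open ℚ.≤-Reasoning

  F⊆HalfOpenUnit : ∀ {x} → F φ x → HalfOpenUnit x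
  F⊆HalfOpenUnit (0<x , x≤1 , _) = 0<x , x≤1

  divergent⇒conull : ∑=∞ (λ n → 2^- φ n) → Null (HalfOpenUnit ∖ F φ)
  divergent⇒conull diverges ε 0<ε = Real.Covering-⊆ {HalfOpenUnit ∖ F φ} (λ {x} → eventually-small {x})
    (SeqCovering⇒CoverTotal (SeqNull-eventually-small e
      (∑=∞⇒Unbounded {λ n → 2^- φ n} (λ n → 2^-≤½^ (φ n) {e n} (φ≰e n)) diverges) ε 0<ε))
    where
    eventually-small : ∀ {x} → (HalfOpenUnit ∖ F φ) x →
      HasExpansionIn (λ d → ∃[ N ] ∀ n → N ℕ.≤ n → d n ℕ.≤ e n) x
    -- Membership in `F φ` asks for some expansion with large digits, so failing it constrains the
    -- greedy one.
    eventually-small {x} ((0<x , x≤1) , x∉F) = digits , isExpansion , ¬¬-elim λ ¬small →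
      x∉F (0<x , x≤1 , digits , isExpansion , λ N → ¬¬-elim λ ¬large →
        ¬small (N , λ n N≤n → ℕ.≮⇒≥ λ e<d → ¬large (n , N≤n , e<⇒φ≤ n e<d)))
      where open Greedy em x 0<x x≤1

theorem1p1 : ExcludedMiddle (Level.suc 0ℓ) → (φ : ℕ → ℝ⁺) →
    (∑<∞ (λ n → 2^- φ n) → 𝓛 F φ ≐ fromℚ 0ℚ)
    × (∑=∞ (λ n → 2^- φ n) → 𝓛 F φ ≐ fromℚ 1ℚ)
theorem1p1 em φ =
    (λ converges → Null⇒measure-0 (convergent⇒Null converges))
  , (λ diverges → conull⇒measure-1 {F φ} (λ {x} → F⊆HalfOpenUnit {x}) (divergent⇒conull diverges))
  where
  open Measure em
  open Dichotomy em φ
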